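{- For any graph $H$ and any positive integer $k$, \[ \delta^{\ast}_{\chi}(H,k)=\delta_{\chi}(H\text{ -hom},k). \]
   Context: All graphs are finite and simple; $\delta(G)$ is minimum degree and $|G|$ the number of vertices; $G$ is $H$-free if it contains no subgraph isomorphic to $H$; $H\to G$ means $H$ is homomorphic to $G$ (there is a map $V(H)\to V(G)$ sending edges to edges). The approximate chromatic profile $\delta^{\ast}_{\chi}(H,k)$ is the infimum of all $c$ such that for every $\eta>0$ there is $n_0$ such that every $H$-free graph $G$ on $n\ge n_0$ vertices with $\delta(G)\ge cn$ can be made $k$-colourable by deleting at most $\eta n^2$ edges. The quantity $\delta_{\chi}(H\text{ -hom},k)$ is the infimum of all $c$ such that every graph $G$ with $\delta(G)\ge c|G|$ and $H$ not homomorphic to $G$ is $k$-colourable. -}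

module Defs where

open import Data.Nat using (ℕ; zero; suc; _∸_; _≥_)
open import Data.Nat as ℕ using ()
open import Data.Bool using (Bool; true; false; if_then_else_; _∧_)
open import Data.Fin using (Fin; toℕ)
open import Data.List using (List; map; allFin)
open import Data.Nat.ListAction using (sum)
open import Data.Integer using (+_)
open import Data.Rational using (ℚ; _/_; _*_; _≤_; _<_; 0ℚ)
open import Data.Product using (Σ; ∃; _×_; _,_)
open import Relation.Binary.PropositionalEquality using (_≡_; _≢_)
open import Relation.Nullary using (¬_)
open import Function.Definitions using (Injective)

record Graph (n : ℕ) : Set where
  field
    adj   : Fin n → Fin n → Bool
    sym   : ∀ u v → adj u v ≡ adj v u
    irrefl : ∀ v → adj v v ≡ false
open Graph public

ℕ→ℚ : ℕ → ℚ
ℕ→ℚ n = (+ n) / 1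

deg : ∀ {n} → Graph n → Fin n → ℕ
deg {n} G v = sum (map (λ u → if adj G v u then 1 else 0) (allFin n))

MinDegAtLeast : ∀ {n} → Graph n → ℚ → Set
MinDegAtLeast {n} G c = ∀ v → c * ℕ→ℚ n ≤ ℕ→ℚ (deg G v)

edges : ∀ {n} → Graph n → ℕ
edges {n} G = sum (map (λ u → sum (map (λ v →
  if adj G u v ∧ (toℕ u ℕ.<ᵇ toℕ v) then 1 else 0) (allFin n))) (allFin n))

SpanningSubgraph : ∀ {n} → Graph n → Graph n → Set
SpanningSubgraph G' G = ∀ u v → adj G' u v ≡ true → adj G u v ≡ true

Hom : ∀ {h n} → Graph h → Graph n → Set
Hom {h} {n} H G = Σ (Fin h → Fin n) λ φ →
  ∀ a b → adj H a b ≡ true → adj G (φ a) (φ b) ≡ true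

ContainsSub : ∀ {h n} → Graph h → Graph n → Set
ContainsSub {h} {n} H G = Σ (Fin h → Fin n) λ φ →
  Injective _≡_ _≡_ φ × (∀ a b → adj H a b ≡ true → adj G (φ a) (φ b) ≡ true)

Free : ∀ {h n} → Graph h → Graph n → Set
Free H G = ¬ ContainsSub H G

Colourable : ∀ {n} → ℕ → Graph n → Set
Colourable {n} k G = Σ (Fin n → Fin k) λ f →
  ∀ u v → adj G u v ≡ true → f u ≢ f v

NearlyColourable : ∀ {n} → ℕ → ℚ → Graph n → Set
NearlyColourable {n} k η G = Σ (Graph n) λ G' →
  SpanningSubgraph G' G × Colourable k G' ×
  ℕ→ℚ (edges G ∸ edges G') ≤ η * (ℕ→ℚ n * ℕ→ℚ n)

-- c belongs to the set whose infimum is δ*_χ(H,k)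
ApproxProfileSet : ∀ {h} → Graph h → ℕ → ℚ → Set
ApproxProfileSet H k c = ∀ (η : ℚ) → 0ℚ < η → ∃ λ n₀ →
  ∀ n (G : Graph n) → n ≥ n₀ → Free H G → MinDegAtLeast G c →
  NearlyColourable k η G

-- c belongs to the set whose infimum is δ_χ(H-hom,k)
HomProfileSet : ∀ {h} → Graph h → ℕ → ℚ → Set
HomProfileSet H k c = ∀ n (G : Graph n) → ¬ Hom H G → MinDegAtLeast G c →
  Colourable k G

-- "inf S < q" for a set S of reals that is upward closed, described by its
-- rational members: inf S < q  iff  some rational r < q lies in S.
InfBelow : (ℚ → Set) → ℚ → Set
InfBelow S q = ∃ λ r → r < q × S r

{-# OPTIONS --safe #-}
module Submission where

-- Approx ⇒ Hom: apply the approximate property to a large blow-up of G and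
-- colour each vertex by the majority colour of its block; a monochromatic edge
-- of G would force t²/k² edges of the t-fold blow-up to have been deleted.
--
-- Hom ⇒ Approx, without the regularity lemma.  Suppose no k-colouring of G has
-- few monochromatic edges.  Following Goldreich, Goldwasser and Ron, a random
-- sample of bounded size then induces a non-k-colourable graph with probability
-- bounded below: given lists of still available colours, many vertices have no
-- colour left or shrink the lists substantially whatever colour they receive,
-- so a bounded tree of such vertices defeats every colouring.  Enlarging the
-- sample preserves the minimum degree ratio except with exponentially small
-- probability (Chernoff), so with positive probability the sample is a
-- homomorphic target of H.  By repeated Cauchy–Schwarz, splitting one vertex of
-- H at a time from the others mapped to the same place, H itself then has
-- positive homomorphism density in G, hence an injective copy once G is large.

open import Defs renaming (sym to adj-sym)
open import Data.Nat
open import Data.Nat.Properties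
open import Data.Nat.Coprimality using (1-coprimeTo)
open import Data.Nat.ListAction using (sum)
open import Data.Nat.ListAction.Properties using (sum-++)
open import Data.Nat.Tactic.RingSolver using (solve-∀)
open import Data.Integer as ℤ using (-[1+_]; +[1+_]) renaming (+_ to pos)
import Data.Integer.Properties as ℤ
import Data.Integer.Tactic.RingSolver as ℤRing
open import Data.Rational as ℚ using (ℚ; mkℚ; ↥_; ↧_; toℚᵘ)
import Data.Rational.Properties as ℚ
open import Data.Rational.Unnormalised as ℚᵘ using (mkℚᵘ)
import Data.Rational.Unnormalised.Properties as ℚᵘ
open import Data.Bool using (Bool; true; false; if_then_else_; _∧_; not)
import Data.Bool.Properties as Bool
open import Data.Fin using (Fin; zero; suc; toℕ; fromℕ<; combine; quotient; remQuot; inject≤; _↑ˡ_; _↑ʳ_)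
import Data.Fin.Properties as Fin
open import Data.List using (List; []; _∷_; map; allFin; length; concatMap; _++_)
open import Data.List.Properties using (map-tabulate; map-++; length-tabulate)
open import Data.List.Membership.Propositional using (_∈_; lose)
open import Data.List.Membership.Propositional.Properties using (∈-map⁺; ∈-allFin; ∈-concatMap⁺)
open import Data.List.Relation.Unary.Any using (here; there)
open import Data.Vec using (Vec; []; _∷_; lookup; _[_]≔_; truncate; tabulate)
import Data.Vec as Vec
open import Data.Vec.Properties using (lookup∘update; lookup∘update′; lookup-++ˡ; lookup-++ʳ; take++drop≡id; lookup∘tabulate; lookup-truncate)
open import Data.Product using (Σ; ∃; _×_; _,_; proj₁; proj₂)
open import Data.Sum using (_⊎_; inj₁; inj₂)
import Data.Sum as Sum
open import Data.Empty using (⊥-elim)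
open import Function using (_∘_; id; it)
open import Function.Definitions using (Injective)
open import Relation.Nullary using (¬_; Dec; yes; no; does; contradiction)
open import Relation.Nullary.Decidable using (_→-dec_; _×-dec_; dec-true; dec-false)
open import Relation.Binary.Definitions using (tri<; tri≈; tri>)
open import Relation.Binary.PropositionalEquality

-- Finite sums

private variable
  A B : Set

∑ : List A → (A → ℕ) → ℕ
∑ xs f = sum (map f xs)

module _ {f g : A → ℕ} where

  ∑-cong : ∀ xs → (∀ x → f x ≡ g x) → ∑ xs f ≡ ∑ xs g
  ∑-cong []       e = refl
  ∑-cong (x ∷ xs) e = cong₂ _+_ (e x) (∑-cong xs e)

  ∑-mono : ∀ xs → (∀ x → f x ≤ g x) → ∑ xs f ≤ ∑ xs g
  ∑-mono []       e = z≤n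
  ∑-mono (x ∷ xs) e = +-mono-≤ (e x) (∑-mono xs e)

  ∑-+ : ∀ xs → ∑ xs (λ x → f x + g x) ≡ ∑ xs f + ∑ xs g
  ∑-+ []       = refl
  ∑-+ (x ∷ xs) = trans (cong (f x + g x +_) (∑-+ xs)) (interchange (f x) (g x) _ _)
    where
    interchange : ∀ a b c d → (a + b) + (c + d) ≡ (a + c) + (b + d)
    interchange = solve-∀

  -- First-moment principle: the only passage from counting to existence, used for the majority
  -- colour of a block and for a good sample.
  ∑-<⇒∃ : ∀ xs → ∑ xs f < ∑ xs g → ∃ λ x → f x < g x
  ∑-<⇒∃ (x ∷ xs) lt with f x <? g x
  ... | yes p = x , p
  ... | no ¬p = ∑-<⇒∃ xs (+-cancelˡ-< (f x) _ _ (<-≤-trans lt (+-monoˡ-≤ _ (≮⇒≥ ¬p))))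

∑-*ˡ : ∀ (xs : List A) c {f : A → ℕ} → ∑ xs (λ x → c * f x) ≡ c * ∑ xs f
∑-*ˡ []       c     = sym (*-zeroʳ c)
∑-*ˡ (x ∷ xs) c {f} = trans (cong (c * f x +_) (∑-*ˡ xs c)) (sym (*-distribˡ-+ c (f x) _))

∑-*ʳ : ∀ (xs : List A) c {f : A → ℕ} → ∑ xs (λ x → f x * c) ≡ ∑ xs f * c
∑-*ʳ xs c {f} = trans (∑-cong xs (λ x → *-comm (f x) c)) (trans (∑-*ˡ xs c) (*-comm c _))

∑-const : ∀ (xs : List A) c → ∑ xs (λ _ → c) ≡ length xs * c
∑-const []       c = refl
∑-const (x ∷ xs) c = cong (c +_) (∑-const xs c)

∑-swap : ∀ (xs : List A) (ys : List B) {f : A → B → ℕ} →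
         ∑ xs (λ x → ∑ ys (f x)) ≡ ∑ ys (λ y → ∑ xs (λ x → f x y))
∑-swap []       ys     = sym (trans (∑-const ys 0) (*-zeroʳ (length ys)))
∑-swap (x ∷ xs) ys {f} = trans (cong (∑ ys (f x) +_) (∑-swap xs ys)) (sym (∑-+ ys))

∑-product : ∀ (xs : List A) (ys : List B) {f : A → ℕ} {g : B → ℕ} →
            ∑ xs (λ x → ∑ ys (λ y → f x * g y)) ≡ ∑ xs f * ∑ ys g
∑-product xs ys {f} {g} = trans (∑-cong xs (λ x → ∑-*ˡ ys (f x))) (∑-*ʳ xs (∑ ys g))

∑-++ : ∀ (xs ys : List A) {f : A → ℕ} → ∑ (xs ++ ys) f ≡ ∑ xs f + ∑ ys f
∑-++ xs ys {f} = trans (cong sum (map-++ f xs ys)) (sum-++ (map f xs) (map f ys))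

∑-map : ∀ (xs : List A) {h : A → B} {f : B → ℕ} → ∑ (map h xs) f ≡ ∑ xs (f ∘ h)
∑-map []           = refl
∑-map (x ∷ xs) {h} {f} = cong (f (h x) +_) (∑-map xs)

∑-concatMap : ∀ (xs : List A) {h : A → List B} {f : B → ℕ} →
              ∑ (concatMap h xs) f ≡ ∑ xs (λ x → ∑ (h x) f)
∑-concatMap []           = refl
∑-concatMap (x ∷ xs) {h} = trans (∑-++ (h x) _) (cong (_ +_) (∑-concatMap xs))

∑-∈ : ∀ {xs : List A} {x} {f : A → ℕ} → x ∈ xs → f x ≤ ∑ xs f
∑-∈ (here refl) = m≤m+n _ _
∑-∈ (there x∈)  = ≤-trans (∑-∈ x∈) (m≤n+m _ _)

2ab≤a²+b² : ∀ a b → 2 * (a * b) ≤ a * a + b * b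
2ab≤a²+b² a b with ≤-total a b
... | inj₁ a≤b with m≤n⇒∃[o]m+o≡n a≤b
...   | d , refl = ≤-trans (m≤m+n _ (d * d)) (≤-reflexive (square a d))
  where
  square : ∀ a d → 2 * (a * (a + d)) + d * d ≡ a * a + (a + d) * (a + d)
  square = solve-∀
2ab≤a²+b² a b | inj₂ b≤a with m≤n⇒∃[o]m+o≡n b≤a
...   | d , refl = ≤-trans (m≤m+n _ (d * d)) (≤-reflexive (square b d))
  where
  square : ∀ b d → 2 * ((b + d) * b) + d * d ≡ (b + d) * (b + d) + b * b
  square = solve-∀

-- Sum `2ab≤a²+b²` over all pairs of terms and halve, so that no subtraction occurs.
∑-cauchySchwarz : ∀ (xs : List A) {f : A → ℕ} →
                  ∑ xs f * ∑ xs f ≤ length xs * ∑ xs (λ x → f x * f x)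
∑-cauchySchwarz xs {f} = *-cancelˡ-≤ 2 (begin
  2 * (∑ xs f * ∑ xs f)                               ≡⟨ cong (2 *_) (∑-product xs xs) ⟨
  2 * ∑ xs (λ x → ∑ xs (λ y → f x * f y))             ≡⟨ ∑-*ˡ xs 2 ⟨
  ∑ xs (λ x → 2 * ∑ xs (λ y → f x * f y))             ≡⟨ ∑-cong xs (λ x → sym (∑-*ˡ xs 2)) ⟩
  ∑ xs (λ x → ∑ xs (λ y → 2 * (f x * f y)))           ≤⟨ ∑-mono xs (λ x → ∑-mono xs (λ y → 2ab≤a²+b² (f x) (f y))) ⟩
  ∑ xs (λ x → ∑ xs (λ y → f x * f x + f y * f y))     ≡⟨ ∑-cong xs (λ x → trans (∑-+ xs) (cong (_+ S) (∑-const xs _))) ⟩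
  ∑ xs (λ x → length xs * (f x * f x) + S)            ≡⟨ ∑-+ xs ⟩
  ∑ xs (λ x → length xs * (f x * f x)) + ∑ xs (λ _ → S) ≡⟨ cong₂ _+_ (∑-*ˡ xs (length xs)) (∑-const xs S) ⟩
  length xs * S + length xs * S                       ≡⟨ cong (length xs * S +_) (+-identityʳ _) ⟨
  2 * (length xs * S)                                 ∎)
  where
  open ≤-Reasoning
  S = ∑ xs (λ x → f x * f x)

∑F : ∀ n → (Fin n → ℕ) → ℕ
∑F n = ∑ (allFin n)

∑F-suc : ∀ n {f : Fin (suc n) → ℕ} → ∑F (suc n) f ≡ f zero + ∑F n (f ∘ suc)
∑F-suc n {f} = cong (f zero +_)
  (trans (cong (λ l → ∑ l f) (sym (map-tabulate id suc))) (∑-map (allFin n)))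

length-allFin : ∀ n → length (allFin n) ≡ n
length-allFin n = length-tabulate id

∑F-const : ∀ n c → ∑F n (λ _ → c) ≡ n * c
∑F-const n c = trans (∑-const (allFin n) c) (cong (_* c) (length-allFin n))

∑F-term : ∀ {n} (i : Fin n) {f : Fin n → ℕ} → f i ≤ ∑F n f
∑F-term i = ∑-∈ (∈-allFin i)

∑F-+ : ∀ m n {f : Fin (m + n) → ℕ} →
       ∑F (m + n) f ≡ ∑F m (λ i → f (i ↑ˡ n)) + ∑F n (λ j → f (m ↑ʳ j))
∑F-+ zero    n         = refl
∑F-+ (suc m) n {f} = trans (∑F-suc (m + n))
  (trans (cong (f zero +_) (∑F-+ m n))
  (trans (sym (+-assoc (f zero) _ _)) (cong (_+ ∑F n (λ j → f (suc (m ↑ʳ j)))) (sym (∑F-suc m)))))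

∑F-* : ∀ m n {f : Fin (m * n) → ℕ} →
       ∑F (m * n) f ≡ ∑F m (λ i → ∑F n (λ j → f (combine i j)))
∑F-* zero    n     = refl
∑F-* (suc m) n {f} = trans (∑F-+ n (m * n))
  (trans (cong (∑F n (λ j → f (j ↑ˡ (m * n))) +_) (∑F-* m n)) (sym (∑F-suc m)))

⟦_⟧ : Bool → ℕ
⟦ b ⟧ = if b then 1 else 0

⟦⟧≤1 : ∀ b → ⟦ b ⟧ ≤ 1
⟦⟧≤1 true  = ≤-refl
⟦⟧≤1 false = z≤n

∑F-δ : ∀ {n} (i : Fin n) → ∑F n (λ j → ⟦ does (i Fin.≟ j) ⟧) ≡ 1
∑F-δ {suc n} zero    = trans (∑F-suc n {λ j → ⟦ does (zero Fin.≟ j) ⟧}) (cong suc (trans (∑F-const n 0) (*-zeroʳ n)))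
∑F-δ {suc n} (suc i) = trans (∑F-suc n {λ j → ⟦ does (suc i Fin.≟ j) ⟧}) (∑F-δ i)

-- Sums over all tuples of a given length

vecs : List A → ∀ N → List (Vec A N)
vecs xs zero    = [] ∷ []
vecs xs (suc N) = concatMap (λ v → map (v ∷_) (vecs xs N)) xs

∈-vecs : ∀ {xs : List A} → (∀ x → x ∈ xs) → ∀ {N} (v : Vec A N) → v ∈ vecs xs N
∈-vecs all []      = here refl
∈-vecs {xs = xs} all (x ∷ v) =
  ∈-concatMap⁺ (λ w → map (w ∷_) (vecs xs _)) (lose (all x) (∈-map⁺ (x ∷_) (∈-vecs all v)))

∑V : ∀ n N → (Vec (Fin n) N → ℕ) → ℕ
∑V n N = ∑ (vecs (allFin n) N)

∑V-suc : ∀ n N {f : Vec (Fin n) (suc N) → ℕ} →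
         ∑V n (suc N) f ≡ ∑F n (λ v → ∑V n N (λ x → f (v ∷ x)))
∑V-suc n N = trans (∑-concatMap (allFin n)) (∑-cong (allFin n) (λ v → ∑-map (vecs (allFin n) N)))

∑V-const : ∀ n N c → ∑V n N (λ _ → c) ≡ n ^ N * c
∑V-const n zero    c = refl
∑V-const n (suc N) c = trans (∑V-suc n N) (trans (∑-cong (allFin n) (λ _ → ∑V-const n N c))
  (trans (∑F-const n _) (sym (*-assoc n (n ^ N) c))))

length-vecs : ∀ n N → length (vecs (allFin n) N) ≡ n ^ N
length-vecs n N = trans (sym (*-identityʳ _)) (trans (sym (∑-const (vecs (allFin n) N) 1))
  (trans (∑V-const n N 1) (*-identityʳ _)))

∑V-term : ∀ {n N} (x : Vec (Fin n) N) {f : Vec (Fin n) N → ℕ} → f x ≤ ∑V n N f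
∑V-term x = ∑-∈ (∈-vecs ∈-allFin x)

∑V-++ : ∀ n M N {f : Vec (Fin n) (M + N) → ℕ} →
        ∑V n (M + N) f ≡ ∑V n M (λ x → ∑V n N (λ y → f (x Vec.++ y)))
∑V-++ n zero    N     = sym (+-identityʳ _)
∑V-++ n (suc M) N {f} = trans (∑V-suc n (M + N))
  (trans (∑-cong (allFin n) (λ v → ∑V-++ n M N)) (sym (∑V-suc n M)))

module _ {P : Set} where

  ⟦does⟧≤ : ∀ {m} (d : Dec P) → (P → 1 ≤ m) → ⟦ does d ⟧ ≤ m
  ⟦does⟧≤ (yes p) le = le p
  ⟦does⟧≤ (no _)  le = z≤n

  ⟦does⟧*≤ : ∀ {c m} (d : Dec P) → (P → c ≤ m) → ⟦ does d ⟧ * c ≤ m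
  ⟦does⟧*≤ (yes p) le = ≤-trans (≤-reflexive (+-identityʳ _)) (le p)
  ⟦does⟧*≤ (no _)  le = z≤n

  ⟦does⟧-yes : (d : Dec P) → P → ⟦ does d ⟧ ≡ 1
  ⟦does⟧-yes (yes _) p = refl
  ⟦does⟧-yes (no ¬p) p = ⊥-elim (¬p p)

⟦does⟧-* : ∀ {P Q : Set} {m} (d : Dec P) (e : Dec Q) → (P → Q → 1 ≤ m) → ⟦ does d ⟧ * ⟦ does e ⟧ ≤ m
⟦does⟧-* (yes p) (yes q) le = le p q
⟦does⟧-* (yes p) (no _)  le = z≤n
⟦does⟧-* (no _)  _       le = z≤n

-- Homomorphism densities

-- Fix all coordinates except `p`, sum `F` over coordinate `p`, and apply Cauchy-Schwarz over the
-- `n ^ N` choices of the fixed ones. The square of the inner sum ranges over two independent values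
-- of coordinate `p`.
∑V-resample : ∀ n N (F : Vec (Fin n) (suc N) → ℕ) (p : Fin (suc N)) →
  ∑V n (suc N) F * ∑V n (suc N) F ≤ n ^ N * ∑V n (suc N) (λ x → ∑F n (λ u → F x * F (x [ p ]≔ u)))
∑V-resample n N F zero = begin
  ∑V n (suc N) F * ∑V n (suc N) F
    ≡⟨ cong₂ _*_ byTail byTail ⟩
  ∑V n N S * ∑V n N S
    ≤⟨ ∑-cauchySchwarz Vs ⟩
  length Vs * ∑V n N (λ y → S y * S y)
    ≡⟨ cong₂ _*_ (length-vecs n N) (∑-cong Vs (λ y → sym (∑-product (allFin n) (allFin n)))) ⟩
  n ^ N * ∑V n N (λ y → ∑F n (λ v → ∑F n (λ u → F (v ∷ y) * F (u ∷ y))))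
    ≡⟨ cong (n ^ N *_) (trans (∑-swap Vs (allFin n)) (sym (∑V-suc n N))) ⟩
  n ^ N * ∑V n (suc N) (λ x → ∑F n (λ u → F x * F (x [ zero ]≔ u))) ∎
  where
  open ≤-Reasoning
  Vs = vecs (allFin n) N
  S : Vec (Fin n) N → ℕ
  S y = ∑F n (λ v → F (v ∷ y))
  byTail : ∑V n (suc N) F ≡ ∑V n N S
  byTail = trans (∑V-suc n N) (∑-swap (allFin n) Vs)
∑V-resample n (suc N) F (suc p) = begin
  ∑V n (2 + N) F * ∑V n (2 + N) F
    ≡⟨ cong₂ _*_ (∑V-suc n (suc N)) (∑V-suc n (suc N)) ⟩
  ∑F n T * ∑F n T
    ≤⟨ ∑-cauchySchwarz (allFin n) ⟩
  length (allFin n) * ∑F n (λ v → T v * T v)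
    ≡⟨ cong (_* ∑F n (λ v → T v * T v)) (length-allFin n) ⟩
  n * ∑F n (λ v → T v * T v)
    ≤⟨ *-monoʳ-≤ n (∑-mono (allFin n) (λ v → ∑V-resample n N (λ y → F (v ∷ y)) p)) ⟩
  n * ∑F n (λ v → n ^ N * R v)
    ≡⟨ cong (n *_) (∑-*ˡ (allFin n) (n ^ N)) ⟩
  n * (n ^ N * ∑F n R)
    ≡⟨ *-assoc n (n ^ N) _ ⟨
  n * n ^ N * ∑F n R
    ≡⟨ cong (n * n ^ N *_) (∑V-suc n (suc N)) ⟨
  n ^ suc N * ∑V n (2 + N) (λ x → ∑F n (λ u → F x * F (x [ suc p ]≔ u))) ∎
  where
  open ≤-Reasoning
  T R : Fin n → ℕ
  T v = ∑V n (suc N) (λ y → F (v ∷ y))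
  R v = ∑V n (suc N) (λ y → ∑F n (λ u → F (v ∷ y) * F (v ∷ (y [ p ]≔ u))))

-- Counts pairs of positions rather than testing injectivity: it bounds the indicator of a
-- non-injective tuple, and its total is easy to compute.
collisions : ∀ {n N} → Vec (Fin n) N → ℕ
collisions         []      = 0
collisions {N = suc N} (v ∷ x) = ∑F N (λ j → ⟦ does (lookup x j Fin.≟ v) ⟧) + collisions x

¬collisions⇒injective : ∀ {n N} (x : Vec (Fin n) N) → collisions x ≡ 0 → Injective _≡_ _≡_ (lookup x)
¬collisions⇒injective {n} (v ∷ x) c≡0 = injective
  where
  distinct : ∀ j → lookup x j ≢ v
  distinct j eq with lookup x j Fin.≟ v | ∑F-term j {λ j → ⟦ does (lookup x j Fin.≟ v) ⟧}
  ... | yes _ | le = contradiction (≤-trans le (≤-reflexive (m+n≡0⇒m≡0 _ c≡0))) λ ()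
  ... | no ¬e | _  = ¬e eq
  injective : Injective _≡_ _≡_ (lookup (v ∷ x))
  injective {zero}  {zero}  _  = refl
  injective {zero}  {suc j} eq = contradiction (sym eq) (distinct j)
  injective {suc i} {zero}  eq = contradiction eq (distinct i)
  injective {suc i} {suc j} eq =
    cong suc (¬collisions⇒injective x (m+n≡0⇒n≡0 (∑F _ (λ j → ⟦ does (lookup x j Fin.≟ v) ⟧)) c≡0) eq)

-- A fixed pair of positions agrees in one tuple out of `n`, and `N * N` generously bounds the
-- number of pairs. The factor `n` on the left avoids the exponent N - 1.
∑V-collisions : ∀ n N → n * ∑V n N collisions ≤ N * N * n ^ N
∑V-collisions n zero    = ≤-reflexive (*-zeroʳ n)
∑V-collisions n (suc N) = begin
  n * ∑V n (suc N) collisions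
    ≡⟨ cong (n *_) (∑V-suc n N) ⟩
  n * ∑F n (λ v → ∑V n N (λ x → hits v x + collisions x))
    ≡⟨ cong (n *_) (trans (∑-cong (allFin n) (λ v → ∑-+ Vs)) (∑-+ (allFin n))) ⟩
  n * (∑F n (λ v → ∑V n N (hits v)) + ∑F n (λ _ → ∑V n N collisions))
    ≡⟨ cong₂ (λ a b → n * (a + b)) total (∑F-const n _) ⟩
  n * (n ^ N * N + n * ∑V n N collisions)
    ≤⟨ *-monoʳ-≤ n (+-monoʳ-≤ (n ^ N * N) (∑V-collisions n N)) ⟩
  n * (n ^ N * N + N * N * n ^ N)
    ≤⟨ m≤m+n _ (n * n ^ N * suc N) ⟩
  n * (n ^ N * N + N * N * n ^ N) + n * n ^ N * suc N
    ≡⟨ expand n (n ^ N) N ⟩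
  suc N * suc N * n ^ suc N ∎
  where
  open ≤-Reasoning
  Vs = vecs (allFin n) N
  hits : Fin n → Vec (Fin n) N → ℕ
  hits v x = ∑F N (λ j → ⟦ does (lookup x j Fin.≟ v) ⟧)
  total : ∑F n (λ v → ∑V n N (hits v)) ≡ n ^ N * N
  total = trans (∑-swap (allFin n) Vs) (trans (∑-cong Vs λ x →
    trans (∑-swap (allFin n) (allFin N)) (trans (∑-cong (allFin N) λ j → ∑F-δ (lookup x j))
      (trans (∑F-const N 1) (*-identityʳ N)))) (∑V-const n N N))
  expand : ∀ n e N → n * (e * N + N * N * e) + n * e * suc N ≡ suc N * suc N * (n * e)
  expand = solve-∀

-- This is K to the power 2^j: each vertex split off squares the reciprocal of the density.
squarings : ℕ → ℕ → ℕ
squarings K zero    = K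
squarings K (suc j) = squarings K j * squarings K j

module _ {h n} (H : Graph h) (G : Graph n) where

  isHom? : (ψ : Fin h → Fin n) → Dec (∀ a b → adj H a b ≡ true → adj G (ψ a) (ψ b) ≡ true)
  isHom? ψ = Fin.all? λ a → Fin.all? λ b → (adj H a b Bool.≟ true) →-dec (adj G (ψ a) (ψ b) Bool.≟ true)

  homIndicator : ∀ {N} → (Fin h → Fin N) → Vec (Fin n) N → ℕ
  homIndicator φ x = ⟦ does (isHom? (lookup x ∘ φ)) ⟧

  homCount : ∀ N → (Fin h → Fin N) → ℕ
  homCount N φ = ∑V n N (homIndicator φ)

  -- The vertex `a` moves to a fresh position `zero`; all other vertices keep their old positions,
  -- including those that shared one with `a`.
  unglue : ∀ {N} → (Fin h → Fin N) → Fin h → Fin h → Fin (suc N)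
  unglue φ a b with a Fin.≟ b
  ... | yes _ = zero
  ... | no  _ = suc (φ b)

  -- No neighbour of `a` shares its position, since a homomorphism would then send an edge to a
  -- loop. Resampling position `φ a` therefore leaves the images of the neighbours alone, so `u` is
  -- adjacent to all of them; edges avoiding `a` are taken from the original tuple.
  unglue-isHom : ∀ {N} (φ : Fin h → Fin N) a x u →
    homIndicator φ x * homIndicator φ (x [ φ a ]≔ u) ≤ homIndicator (unglue φ a) (u ∷ x)
  unglue-isHom φ a x u = ⟦does⟧-* (isHom? (lookup x ∘ φ)) (isHom? (lookup (x [ φ a ]≔ u) ∘ φ)) λ hom₁ hom₂ →
    ≤-reflexive (sym (⟦does⟧-yes (isHom? (lookup (u ∷ x) ∘ unglue φ a)) (hom hom₁ hom₂)))
    where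
    module _ (hom₁ : ∀ b c → adj H b c ≡ true → adj G (lookup x (φ b)) (lookup x (φ c)) ≡ true)
             (hom₂ : ∀ b c → adj H b c ≡ true →
                     adj G (lookup (x [ φ a ]≔ u) (φ b)) (lookup (x [ φ a ]≔ u) (φ c)) ≡ true) where
      apart : ∀ b → adj H a b ≡ true → φ b ≢ φ a
      apart b ab eq with trans (sym (hom₁ a b ab)) (trans (cong (adj G _) (cong (lookup x) eq)) (irrefl G _))
      ... | ()
      new : ∀ b → adj H a b ≡ true → adj G u (lookup x (φ b)) ≡ true
      new b ab = subst₂ (λ v w → adj G v w ≡ true) (lookup∘update (φ a) x u)
        (lookup∘update′ (apart b ab) x u) (hom₂ a b ab)
      hom : ∀ b c → adj H b c ≡ true →
            adj G (lookup (u ∷ x) (unglue φ a b)) (lookup (u ∷ x) (unglue φ a c)) ≡ true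
      hom b c bc with a Fin.≟ b | a Fin.≟ c
      ... | yes refl | yes refl = contradiction (trans (sym bc) (irrefl H a)) λ ()
      ... | yes refl | no _     = new c bc
      ... | no _     | yes refl = trans (adj-sym G _ _) (new b (trans (adj-sym H _ _) bc))
      ... | no _     | no _     = hom₁ b c bc

  -- Square the density bound, resample coordinate `φ a` by `∑V-resample`, and read each resulting
  -- pair of homomorphisms as one for the unglued map.
  unglue-count : ∀ {N} .{{_ : NonZero n}} K (φ : Fin h → Fin N) a →
    n ^ N ≤ K * homCount N φ → n ^ suc N ≤ K * K * homCount (suc N) (unglue φ a)
  unglue-count {zero}  K φ a dense with φ a
  ... | ()
  unglue-count {suc N} K φ a dense = *-cancelˡ-≤ (n ^ N) {{m^n≢0 n N}} (begin
    n ^ N * (n * (n * n ^ N))             ≡⟨ regroup (n ^ N) n ⟩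
    n ^ suc N * n ^ suc N                 ≤⟨ *-mono-≤ dense dense ⟩
    (K * X) * (K * X)                     ≡⟨ regroup′ K X ⟩
    K * K * (X * X)                       ≤⟨ *-monoʳ-≤ (K * K) (∑V-resample n N (homIndicator φ) (φ a)) ⟩
    K * K * (n ^ N * ∑V n (suc N) (λ x → ∑F n (λ u → homIndicator φ x * homIndicator φ (x [ φ a ]≔ u))))
      ≤⟨ *-monoʳ-≤ (K * K) (*-monoʳ-≤ (n ^ N)
           (∑-mono (vecs (allFin n) (suc N)) λ x → ∑-mono (allFin n) λ u → unglue-isHom φ a x u)) ⟩
    K * K * (n ^ N * ∑V n (suc N) (λ x → ∑F n (λ u → homIndicator (unglue φ a) (u ∷ x))))
      ≡⟨ cong (λ s → K * K * (n ^ N * s)) (trans (∑-swap (vecs (allFin n) (suc N)) (allFin n)) (sym (∑V-suc n (suc N)))) ⟩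
    K * K * (n ^ N * X′)                  ≡⟨ regroup″ (K * K) (n ^ N) X′ ⟩
    n ^ N * (K * K * X′)                  ∎)
    where
    open ≤-Reasoning
    X = homCount (suc N) φ
    X′ = homCount (2 + N) (unglue φ a)
    regroup : ∀ e n → e * (n * (n * e)) ≡ (n * e) * (n * e)
    regroup = solve-∀
    regroup′ : ∀ K X → (K * X) * (K * X) ≡ K * K * (X * X)
    regroup′ = solve-∀
    regroup″ : ∀ a b c → a * (b * c) ≡ b * (a * c)
    regroup″ = solve-∀

  -- Only `b` is bounded: a vertex already split off is alone at its position, while the others may
  -- still share one. At `j = h` this is injectivity.
  SeparatesBelow : ∀ {N} → ℕ → (Fin h → Fin N) → Set
  SeparatesBelow j φ = ∀ b c → toℕ b < j → φ b ≡ φ c → b ≡ c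

  unglue-separates : ∀ {N} (φ : Fin h → Fin N) {j} a → toℕ a ≡ j →
    SeparatesBelow j φ → SeparatesBelow (suc j) (unglue φ a)
  unglue-separates φ a a≡j sep b c b<1+j eq with a Fin.≟ b | a Fin.≟ c
  ... | yes refl | yes refl = refl
  ... | yes refl | no _     = contradiction eq λ ()
  ... | no _     | yes refl = contradiction eq λ ()
  ... | no a≢b   | no _     = sep b c
    (≤∧≢⇒< (s≤s⁻¹ b<1+j) λ b≡j → a≢b (Fin.toℕ-injective (trans a≡j (sym b≡j)))) (Fin.suc-injective eq)

  separate : ∀ {N} .{{_ : NonZero n}} K (φ : Fin h → Fin N) → n ^ N ≤ K * homCount N φ →
    ∀ j → j ≤ h → Σ (Fin h → Fin (j + N)) λ φ′ →
      SeparatesBelow j φ′ × n ^ (j + N) ≤ squarings K j * homCount (j + N) φ′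
  separate K φ dense zero    _   = φ , (λ _ _ ()) , dense
  separate K φ dense (suc j) j<h with separate K φ dense j (<⇒≤ j<h)
  ... | φ′ , sep , dense′ = unglue φ′ a
        , unglue-separates φ′ a (Fin.toℕ-fromℕ< j<h) sep , unglue-count (squarings K j) φ′ a dense′
    where a = fromℕ< j<h

  homIndicator≤collisions : Free H G → ∀ {N} (φ : Fin h → Fin N) → SeparatesBelow h φ →
    ∀ x → homIndicator φ x ≤ collisions x
  homIndicator≤collisions free φ sep x = ⟦does⟧≤ (isHom? (lookup x ∘ φ)) λ hom →
    n≢0⇒n>0 λ c≡0 → free (lookup x ∘ φ ,
      (λ {b} {c} eq → sep b c (Fin.toℕ<n b) (¬collisions⇒injective x c≡0 eq)) , hom)

  -- If the density of homomorphisms along `φ` exceeded 1/K, splitting off all `h` vertices would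
  -- leave density at least 1/S for an injective map into `L` positions, with S the value of
  -- `squarings K h`. Since `G` is `H`-free, every such homomorphism has a collision, and collisions
  -- have density at most L²/n, which is below 1/S.
  few-homs : Free H G → ∀ N K → squarings K h * ((h + N) * (h + N)) < n →
    ∀ φ → K * homCount N φ ≤ n ^ N
  few-homs free N K large φ with K * homCount N φ ≤? n ^ N
  ... | yes le = le
  ... | no ¬le with separate {{>-nonZero (≤-trans (s≤s z≤n) large)}} K φ (<⇒≤ (≰⇒> ¬le)) h ≤-refl
  ... | φ′ , sep , dense = contradiction (*-cancelˡ-≤ (n ^ L) {{m^n≢0 n L}} (begin
    n ^ L * n                                ≡⟨ *-comm (n ^ L) n ⟩
    n * n ^ L                                ≤⟨ *-monoʳ-≤ n dense ⟩
    n * (S * homCount L φ′)                  ≤⟨ *-monoʳ-≤ n (*-monoʳ-≤ S (∑-mono (vecs (allFin n) L) (homIndicator≤collisions free φ′ sep))) ⟩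
    n * (S * ∑V n L collisions)              ≡⟨ regroup n S _ ⟩
    S * (n * ∑V n L collisions)              ≤⟨ *-monoʳ-≤ S (∑V-collisions n L) ⟩
    S * (L * L * n ^ L)                      ≡⟨ regroup′ S (L * L) (n ^ L) ⟩
    n ^ L * (S * (L * L))                    ∎)) (<⇒≱ large)
    where
    open ≤-Reasoning
    instance _ = >-nonZero (≤-trans (s≤s z≤n) large)
    L = h + N
    S = squarings K h
    regroup : ∀ a b c → a * (b * c) ≡ b * (a * c)
    regroup = solve-∀
    regroup′ : ∀ a b c → a * (b * c) ≡ c * (a * b)
    regroup′ = solve-∀

-- Testing k-colourability

-- Keeps the case distinctions constructive: in `many-refutes` a `Close` found in any branch ends
-- the search.
collect : ∀ {n} {P : Fin n → Set} → (∀ i → A ⊎ P i) → A ⊎ (∀ i → P i)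
collect {n = zero}  f = inj₂ λ ()
collect {n = suc n} f with f zero | collect (f ∘ suc)
... | inj₁ a | _      = inj₁ a
... | inj₂ p | inj₁ a = inj₁ a
... | inj₂ p | inj₂ q = inj₂ λ { zero → p ; (suc i) → q i }

take-++ : ∀ {m l} (x : Vec A m) (y : Vec A l) → Vec.take m (x Vec.++ y) ≡ x
take-++ []      y = refl
take-++ (v ∷ x) y = cong (v ∷_) (take-++ x y)

drop-++ : ∀ {m l} (x : Vec A m) (y : Vec A l) → Vec.drop m (x Vec.++ y) ≡ y
drop-++ []      y = refl
drop-++ (v ∷ x) y = drop-++ x y

lookup-take : ∀ m {l} (x : Vec A (m + l)) j → lookup (Vec.take m x) j ≡ lookup x (j ↑ˡ l)
lookup-take m x j = trans (sym (lookup-++ˡ (Vec.take m x) (Vec.drop m x) j))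
  (cong (λ z → lookup z (j ↑ˡ _)) (take++drop≡id m x))

lookup-drop : ∀ m {l} (x : Vec A (m + l)) j → lookup (Vec.drop m x) j ≡ lookup x (m ↑ʳ j)
lookup-drop m x j = trans (sym (lookup-++ʳ (Vec.take m x) (Vec.drop m x) j))
  (cong (λ z → lookup z (m ↑ʳ j)) (take++drop≡id m x))

∑V-take*drop : ∀ n m l {f : Vec (Fin n) m → ℕ} {g : Vec (Fin n) l → ℕ} →
  ∑V n (m + l) (λ y → f (Vec.take m y) * g (Vec.drop m y)) ≡ ∑V n m f * ∑V n l g
∑V-take*drop n m l {f} {g} = trans (∑V-++ n m l)
  (trans (∑-cong (vecs (allFin n) m) λ x → ∑-cong (vecs (allFin n) l) λ y →
     cong₂ (λ a b → f a * g b) (take-++ x y) (drop-++ x y))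
   (∑-product (vecs (allFin n) m) (vecs (allFin n) l)))

m*n≢0⇒ : ∀ m n → m * n ≢ 0 → m ≢ 0 × n ≢ 0
m*n≢0⇒ m n ≢0 = (λ { refl → ≢0 refl }) , (λ { refl → ≢0 (*-zeroʳ m) })

blocks : ∀ {m} k → (Fin k → Vec A m → ℕ) → Vec A (k * m) → ℕ
blocks         zero    f y = 1
blocks {m = m} (suc k) f y = f zero (Vec.take m y) * blocks k (f ∘ suc) (Vec.drop m y)

-- Disjoint blocks of a uniform tuple are independent, so their densities multiply.
blocks-∑ : ∀ n m k C (f : Fin k → Vec (Fin n) m → ℕ) → (∀ i → n ^ m ≤ C * ∑V n m (f i)) →
  n ^ (k * m) ≤ C ^ k * ∑V n (k * m) (blocks k f)
blocks-∑ n m zero    C f le = ≤-refl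
blocks-∑ n m (suc k) C f le = begin
  n ^ (m + k * m)                          ≡⟨ ^-distribˡ-+-* n m (k * m) ⟩
  n ^ m * n ^ (k * m)                      ≤⟨ *-mono-≤ (le zero) (blocks-∑ n m k C (f ∘ suc) (le ∘ suc)) ⟩
  C * S * (C ^ k * T)                      ≡⟨ regroup C S (C ^ k) T ⟩
  C * C ^ k * (S * T)                      ≡⟨ cong (C * C ^ k *_) (∑V-take*drop n m (k * m)) ⟨
  C ^ suc k * ∑V n (suc k * m) (blocks (suc k) f) ∎
  where
  open ≤-Reasoning
  S = ∑V n m (f zero)
  T = ∑V n (k * m) (blocks k (f ∘ suc))
  regroup : ∀ a b c d → a * b * (c * d) ≡ a * c * (b * d)
  regroup = solve-∀

blocks≤1 : ∀ {m} k (f : Fin k → Vec A m → ℕ) → (∀ i z → f i z ≤ 1) → ∀ y → blocks k f y ≤ 1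
blocks≤1         zero    f le y = ≤-refl
blocks≤1 {m = m} (suc k) f le y = *-mono-≤ (le zero (Vec.take m y)) (blocks≤1 k (f ∘ suc) (le ∘ suc) (Vec.drop m y))

blocks≢0 : ∀ {m} k (f : Fin k → Vec A m → ℕ) y → blocks k f y ≢ 0 →
  ∀ i → Σ (Vec A m) λ z → f i z ≢ 0 × (∀ j → lookup z j ≡ lookup y (combine i j))
blocks≢0 {m = m} (suc k) f y ≢0 zero =
  Vec.take m y , proj₁ (m*n≢0⇒ (f zero (Vec.take m y)) _ ≢0) , lookup-take m y
blocks≢0 {m = m} (suc k) f y ≢0 (suc i)
  with blocks≢0 k (f ∘ suc) (Vec.drop m y) (proj₂ (m*n≢0⇒ (f zero (Vec.take m y)) _ ≢0)) i
... | z , z≢0 , eq = z , z≢0 , λ j → trans (eq j) (lookup-drop m y (combine i j))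

-- Ordered pairs are counted, hence each monochromatic edge twice, which is harmless for an upper
-- bound.
monochromatic : ∀ {n k} → Graph n → (Fin n → Fin k) → ℕ
monochromatic {n} G g = ∑F n λ u → ∑F n λ w → ⟦ adj G u w ∧ does (g u Fin.≟ g w) ⟧

-- Number of vertices of the complete `k`-ary tree of depth `t`: one sampled vertex, then one
-- subtree for each colour it may receive.
trials : ℕ → ℕ → ℕ
trials k zero    = 0
trials k (suc t) = suc (k * trials k t)

-- Reciprocal of the density of refuting samples: a factor `D` for a stuck root and one factor for
-- each of the `k` independent subtrees.
cost : ℕ → ℕ → ℕ → ℕ
cost k D zero    = 1
cost k D (suc t) = D * cost k D t ^ k

cost≢0 : ∀ k D .{{_ : NonZero D}} t → NonZero (cost k D t)
cost≢0 k D zero    = _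
cost≢0 k D (suc t) = m*n≢0 D _ {{it}} {{m^n≢0 _ k {{cost≢0 k D t}}}}

module _ {n} (G : Graph n) (k D : ℕ) where

  Lists : Set
  Lists = Fin n → Fin k → Bool

  size : Lists → ℕ
  size L = ∑F n λ v → ∑F k λ i → ⟦ L v i ⟧

  load : Lists → Fin n → Fin k → ℕ
  load L v i = ∑F n λ w → ⟦ adj G v w ∧ L w i ⟧

  prune : Lists → Fin n → Fin k → Lists
  prune L v i w j = L w j ∧ not (adj G v w ∧ does (i Fin.≟ j))

  -- Giving `v` the colour `i` strikes `i` from the lists of its neighbours, and `load` counts these
  -- strikes. To compare entry by entry, `spread` writes the load as a sum over colours concentrated
  -- at `i`.
  prune-size : ∀ L v i → size (prune L v i) + load L v i ≤ size L
  prune-size L v i = begin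
    size (prune L v i) + load L v i
      ≡⟨ ∑-+ (allFin n) ⟨
    ∑F n (λ w → ∑F k (λ j → ⟦ prune L v i w j ⟧) + ⟦ adj G v w ∧ L w i ⟧)
      ≡⟨ ∑-cong (allFin n) (λ w → trans (cong (∑F k (λ j → ⟦ prune L v i w j ⟧) +_) (spread w)) (sym (∑-+ (allFin k)))) ⟩
    ∑F n (λ w → ∑F k (λ j → ⟦ prune L v i w j ⟧ + ⟦ does (i Fin.≟ j) ⟧ * ⟦ adj G v w ∧ L w i ⟧))
      ≤⟨ ∑-mono (allFin n) (λ w → ∑-mono (allFin k) (pointwise w)) ⟩
    size L ∎
    where
    open ≤-Reasoning
    spread : ∀ w → ⟦ adj G v w ∧ L w i ⟧ ≡ ∑F k (λ j → ⟦ does (i Fin.≟ j) ⟧ * ⟦ adj G v w ∧ L w i ⟧)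
    spread w = sym (trans (∑-*ʳ (allFin k) _) (trans (cong (_* ⟦ adj G v w ∧ L w i ⟧) (∑F-δ i)) (+-identityʳ _)))
    pointwise : ∀ w j → ⟦ prune L v i w j ⟧ + ⟦ does (i Fin.≟ j) ⟧ * ⟦ adj G v w ∧ L w i ⟧ ≤ ⟦ L w j ⟧
    pointwise w j with i Fin.≟ j | adj G v w
    ... | yes refl | true  with L w i
    ...   | true  = ≤-refl
    ...   | false = ≤-refl
    pointwise w j | yes refl | false with L w i
    ...   | true  = ≤-refl
    ...   | false = ≤-refl
    pointwise w j | no _ | true  with L w j
    ...   | true  = ≤-refl
    ...   | false = ≤-refl
    pointwise w j | no _ | false with L w j
    ...   | true  = ≤-refl
    ...   | false = ≤-refl

  -- Choosing such a colour shortens the lists by fewer than n/D entries in total.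
  LightColour : Lists → Fin n → Set
  LightColour L v = ∃ λ i → L v i ≡ true × D * load L v i < n

  lightColour? : ∀ L v → Dec (LightColour L v)
  lightColour? L v = Fin.any? λ i → (L v i Bool.≟ true) ×-dec (D * load L v i <? n)

  -- A vertex with an empty list is stuck too.
  stuck : Lists → Fin n → ℕ
  stuck L v = ⟦ not (does (lightColour? L v)) ⟧

  Close : Set
  Close = Σ (Fin n → Fin k) λ g → D * monochromatic G g ≤ 3 * (n * n)

  -- Give every vertex that is not stuck a light colour. In a monochromatic pair `u`, `w` either an
  -- end is stuck, or the common colour is on the list of `w` and the pair is counted by the load of
  -- `u`. The cases `u` stuck, `w` stuck and light each contribute at most n²/D, whence the 3.
  few-stuck⇒Close : Fin k → ∀ L → D * ∑F n (stuck L) < n → Close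
  few-stuck⇒Close i₀ L few = g , (begin
    D * monochromatic G g
      ≤⟨ *-monoʳ-≤ D (∑-mono (allFin n) λ u → ∑-mono (allFin n) λ w →
           pointwise u w (lightColour? L u) (lightColour? L w)) ⟩
    D * ∑F n (λ u → ∑F n (λ w → stuck L u + stuck L w + r u w))
      ≡⟨ cong (D *_) (∑-cong (allFin n) inner) ⟩
    D * ∑F n (λ u → n * stuck L u + S + free u * load L u (g u))
      ≡⟨ cong (D *_) (trans (∑-+ (allFin n)) (cong (_+ R) outer)) ⟩
    D * (n * S + n * S + R)
      ≡⟨ regroup D n S R ⟩
    n * (D * S) + n * (D * S) + D * R
      ≤⟨ +-mono-≤ (+-mono-≤ (*-monoʳ-≤ n (<⇒≤ few)) (*-monoʳ-≤ n (<⇒≤ few))) light ⟩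
    n * n + n * n + n * n
      ≡⟨ triple (n * n) ⟩
    3 * (n * n) ∎)
    where
    open ≤-Reasoning
    pick : ∀ {v} → Dec (LightColour L v) → Fin k
    pick (yes (i , _)) = i
    -- An arbitrary colour: pairs meeting a stuck vertex are already paid for.
    pick (no _)        = i₀
    g : Fin n → Fin k
    g v = pick (lightColour? L v)
    free : Fin n → ℕ
    free u = ⟦ does (lightColour? L u) ⟧
    r : Fin n → Fin n → ℕ
    r u w = free u * ⟦ adj G u w ∧ L w (g u) ⟧
    S = ∑F n (stuck L)
    R = ∑F n (λ u → free u * load L u (g u))
    inner : ∀ u → ∑F n (λ w → stuck L u + stuck L w + r u w) ≡ n * stuck L u + S + free u * load L u (g u)
    inner u = trans (∑-+ (allFin n)) (cong₂ _+_
      (trans (∑-+ (allFin n)) (cong (_+ S) (∑F-const n (stuck L u)))) (∑-*ˡ (allFin n) (free u)))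
    outer : ∑F n (λ u → n * stuck L u + S) ≡ n * S + n * S
    outer = trans (∑-+ (allFin n)) (cong₂ _+_ (∑-*ˡ (allFin n) n) (∑F-const n S))
    pointwise : ∀ u w (du : Dec (LightColour L u)) (dw : Dec (LightColour L w)) →
      ⟦ adj G u w ∧ does (pick du Fin.≟ pick dw) ⟧ ≤
      ⟦ not (does du) ⟧ + ⟦ not (does dw) ⟧ + ⟦ does du ⟧ * ⟦ adj G u w ∧ L w (pick du) ⟧
    pointwise u w (no _)  dw     = ≤-trans (⟦⟧≤1 (adj G u w ∧ _)) (s≤s z≤n)
    pointwise u w (yes _) (no _) = ≤-trans (⟦⟧≤1 (adj G u w ∧ _)) (s≤s z≤n)
    pointwise u w (yes (i , _)) (yes (j , Lwj , _)) with adj G u w | i Fin.≟ j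
    ... | false | _ = z≤n
    ... | true | no _ = z≤n
    ... | true | yes refl rewrite Lwj = ≤-refl
    bound : ∀ u (du : Dec (LightColour L u)) → D * (⟦ does du ⟧ * load L u (pick du)) ≤ n
    bound u (no _)  = ≤-trans (≤-reflexive (*-zeroʳ D)) z≤n
    bound u (yes (i , _ , lt)) = ≤-trans (≤-reflexive (cong (D *_) (+-identityʳ _))) (<⇒≤ lt)
    light : D * R ≤ n * n
    light = ≤-trans (≤-reflexive (sym (∑-*ˡ (allFin n) D)))
      (≤-trans (∑-mono (allFin n) λ u → bound u (lightColour? L u)) (≤-reflexive (∑F-const n n)))
    regroup : ∀ D n S R → D * (n * S + n * S + R) ≡ n * (D * S) + n * (D * S) + D * R
    regroup = solve-∀
    triple : ∀ a → a + a + a ≡ 3 * a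
    triple = solve-∀

  -- The first sample vertex is stuck, and the i-th of the following k blocks refutes
  -- every colouring that gives it colour i.
  refutes : ∀ t → Lists → Vec (Fin n) (trials k t) → ℕ
  branch : ∀ t → Lists → Fin n → Fin k → Vec (Fin n) (trials k t) → ℕ
  refutes zero    L x       = 0
  refutes (suc t) L (v ∷ y) = stuck L v * blocks k (branch t L v) y
  branch t L v i z = if L v i then refutes t (prune L v i) z else 1

  refutes≤1 : ∀ t L x → refutes t L x ≤ 1
  refutes≤1 zero    L x       = z≤n
  refutes≤1 (suc t) L (v ∷ y) = *-mono-≤ (⟦⟧≤1 (not (does (lightColour? L v)))) (blocks≤1 k (branch t L v) branch≤1 y)
    where
    branch≤1 : ∀ i z → branch t L v i z ≤ 1
    branch≤1 i z with L v i
    ... | true  = refutes≤1 t (prune L v i) z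
    ... | false = ≤-refl

  -- Follow the colour that `f` gives to the first vertex into its block. A proper `f` never repeats
  -- this colour on a neighbour, so it still fits the pruned lists there; at depth zero nothing
  -- refutes.
  refutes-sound : ∀ t L x → refutes t L x ≢ 0 → (f : Fin (trials k t) → Fin k) →
    (∀ i → L (lookup x i) (f i) ≡ true) →
    ¬ (∀ i j → adj G (lookup x i) (lookup x j) ≡ true → f i ≢ f j)
  refutes-sound zero    L x       ≢0 f fits proper = ≢0 refl
  refutes-sound (suc t) L (v ∷ y) ≢0 f fits proper
    with blocks≢0 k (branch t L v) y (proj₂ (m*n≢0⇒ (stuck L v) _ ≢0)) (f zero)
  ... | z , z≢0 , eq = refutes-sound t (prune L v c) z (subst (λ b → (if b then refutes t (prune L v c) z else 1) ≢ 0) (fits zero) z≢0)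
        (λ j → f (suc (combine c j))) fits′
        (λ i j ij → proper (suc (combine c i)) (suc (combine c j))
                      (subst₂ (λ a b → adj G a b ≡ true) (eq i) (eq j) ij))
    where
    c = f zero
    fits′ : ∀ j → prune L v c (lookup z j) (f (suc (combine c j))) ≡ true
    fits′ j rewrite eq j | fits (suc (combine c j)) with adj G v (lookup y (combine c j)) in vy
    ... | false = refl
    ... | true  = cong not (dec-false (c Fin.≟ _) (proper zero (suc (combine c j)) vy))

  -- `t` is a budget for the list entries in units of n/D. With fewer than n/D stuck vertices, the
  -- light colours give `Close`. Otherwise every listed colour of a stuck vertex is heavy, so
  -- pruning spends one unit and the induction hypothesis applies to its block; unlisted colours
  -- need no refutation. The bound on the size rules out `t = 0`.
  many-refutes : .{{_ : NonZero D}} → Fin k → ∀ t L → D * size L < t * n →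
    Close ⊎ n ^ trials k t ≤ cost k D t * ∑V n (trials k t) (refutes t L)
  many-refutes i₀ (suc t) L small with D * ∑F n (stuck L) <? n
  ... | yes few = inj₁ (few-stuck⇒Close i₀ L few)
  ... | no ¬few = Sum.map₂ combineBounds (collect λ v → dense v (lightColour? L v))
    where
    open ≤-Reasoning
    m = trials k t
    C = cost k D t
    instance C≢0 = cost≢0 k D t
    Y : Fin n → ℕ
    Y v = ∑V n (k * m) (blocks k (branch t L v))
    child : ∀ v → ¬ LightColour L v → ∀ i → Close ⊎ n ^ m ≤ C * ∑V n m (branch t L v i)
    child v ¬light i with L v i in Lvi
    ... | false = inj₂ (≤-trans (m≤n*m (n ^ m) C) (≤-reflexive (cong (C *_) (sym (trans (∑V-const n m 1) (*-identityʳ _))))))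
    ... | true  = many-refutes i₀ t (prune L v i) (+-cancelˡ-< n _ _ (begin-strict
      n + D * size (prune L v i)             ≤⟨ +-monoˡ-≤ _ (≮⇒≥ λ lt → ¬light (i , Lvi , lt)) ⟩
      D * load L v i + D * size (prune L v i) ≡⟨ +-comm (D * load L v i) _ ⟩
      D * size (prune L v i) + D * load L v i ≡⟨ *-distribˡ-+ D _ _ ⟨
      D * (size (prune L v i) + load L v i)  ≤⟨ *-monoʳ-≤ D (prune-size L v i) ⟩
      D * size L                             <⟨ small ⟩
      n + t * n                              ∎))
    dense : ∀ v (d : Dec (LightColour L v)) →
      Close ⊎ ⟦ not (does d) ⟧ * n ^ (k * m) ≤ ⟦ not (does d) ⟧ * (C ^ k * Y v)
    dense v (yes _)     = inj₂ z≤n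
    dense v (no ¬light) = Sum.map₂ (λ le → *-monoʳ-≤ 1 (blocks-∑ n m k C (branch t L v) le)) (collect (child v ¬light))
    combineBounds : (∀ v → stuck L v * n ^ (k * m) ≤ stuck L v * (C ^ k * Y v)) →
      n ^ trials k (suc t) ≤ cost k D (suc t) * ∑V n (trials k (suc t)) (refutes (suc t) L)
    combineBounds le = begin
      n * n ^ (k * m)                            ≤⟨ *-monoˡ-≤ _ (≮⇒≥ ¬few) ⟩
      D * ∑F n (stuck L) * n ^ (k * m)           ≡⟨ *-assoc D _ _ ⟩
      D * (∑F n (stuck L) * n ^ (k * m))         ≡⟨ cong (D *_) (∑-*ʳ (allFin n) _) ⟨
      D * ∑F n (λ v → stuck L v * n ^ (k * m))   ≤⟨ *-monoʳ-≤ D (∑-mono (allFin n) le) ⟩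
      D * ∑F n (λ v → stuck L v * (C ^ k * Y v)) ≡⟨ cong (D *_) (∑-cong (allFin n) λ v → regroup (stuck L v) (C ^ k) (Y v)) ⟩
      D * ∑F n (λ v → C ^ k * (stuck L v * Y v)) ≡⟨ cong (D *_) (∑-*ˡ (allFin n) (C ^ k)) ⟩
      D * (C ^ k * ∑F n (λ v → stuck L v * Y v)) ≡⟨ *-assoc D (C ^ k) _ ⟨
      D * C ^ k * ∑F n (λ v → stuck L v * Y v)
        ≡⟨ cong (D * C ^ k *_) (trans (∑-cong (allFin n) λ v → sym (∑-*ˡ (vecs (allFin n) (k * m)) (stuck L v))) (sym (∑V-suc n (k * m)))) ⟩
      D * C ^ k * ∑V n (suc (k * m)) (refutes (suc t) L) ∎
      where
      regroup : ∀ a b c → a * (b * c) ≡ b * (a * c)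
      regroup = solve-∀

-- Degrees in a random sample

^-distribʳ-* : ∀ j x y → (x * y) ^ j ≡ x ^ j * y ^ j
^-distribʳ-* zero    x y = refl
^-distribʳ-* (suc j) x y = trans (cong (x * y *_) (^-distribʳ-* j x y)) (regroup x y (x ^ j) (y ^ j))
  where
  regroup : ∀ a b c d → a * b * (c * d) ≡ a * c * (b * d)
  regroup = solve-∀

-- The quadratic term `j * (y * y)` is all that the induction discards; no division is involved.
bernoulli : ∀ x y j → x ^ j * (x + j * y) ≤ (x + y) ^ j * x
bernoulli x y zero    = ≤-reflexive (cong (1 *_) (+-identityʳ x))
bernoulli x y (suc j) = begin
  x * x ^ j * (x + (y + j * y))                        ≤⟨ m≤m+n _ (x ^ j * (j * (y * y))) ⟩
  x * x ^ j * (x + (y + j * y)) + x ^ j * (j * (y * y)) ≡⟨ regroup x y j (x ^ j) ⟩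
  (x + y) * (x ^ j * (x + j * y))                      ≤⟨ *-monoʳ-≤ (x + y) (bernoulli x y j) ⟩
  (x + y) * ((x + y) ^ j * x)                          ≡⟨ *-assoc (x + y) _ x ⟨
  (x + y) ^ suc j * x                                  ∎
  where
  open ≤-Reasoning
  regroup : ∀ x y j e → x * e * (x + (y + j * y)) + e * (j * (y * y)) ≡ (x + y) * (e * (x + j * y))
  regroup = solve-∀

-- With m = 1 + A this is (1 − 1/m)^p ≥ 1 − p/m.
bernoulli⁻ : ∀ A p d → suc A ≡ p + d → suc A ^ p * d ≤ suc A * A ^ p
bernoulli⁻ A zero    d eq = ≤-reflexive (trans (+-identityʳ d) (trans (sym eq) (sym (*-identityʳ (suc A)))))
bernoulli⁻ A (suc p) d eq = begin
  suc A * suc A ^ p * d         ≤⟨ m≤m+n _ (p * suc A ^ p) ⟩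
  suc A * suc A ^ p * d + p * suc A ^ p ≡⟨ cong (λ a → suc a * suc A ^ p * d + p * suc A ^ p) A≡p+d ⟩
  suc (p + d) * suc A ^ p * d + p * suc A ^ p ≡⟨ regroup p d (suc A ^ p) ⟩
  (p + d) * (suc A ^ p * suc d) ≡⟨ cong (_* (suc A ^ p * suc d)) A≡p+d ⟨
  A * (suc A ^ p * suc d)       ≤⟨ *-monoʳ-≤ A (bernoulli⁻ A p (suc d) (trans eq (sym (+-suc p d)))) ⟩
  A * (suc A * A ^ p)           ≡⟨ regroup′ A (suc A) (A ^ p) ⟩
  suc A * (A * A ^ p)           ∎
  where
  open ≤-Reasoning
  A≡p+d : A ≡ p + d
  A≡p+d = suc-injective eq
  regroup : ∀ p d e → suc (p + d) * e * d + p * e ≡ (p + d) * (e * suc d)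
  regroup = solve-∀
  regroup′ : ∀ a b c → a * (b * c) ≡ b * (a * c)
  regroup′ = solve-∀

-- Bernoulli on the whole exponent yields only linear growth, so it is applied to each half `j` of N
-- and the results are multiplied: (1 + 1/b)^N is at least j²/b². The choice of `j` makes this equal
-- to `K * N`.
beats-linear : ∀ b K → .{{_ : NonZero b}} → ∃ λ N → K ≤ N × K * N * b ^ N ≤ suc b ^ N
beats-linear b K = N , K≤N , *-cancelʳ-≤ _ _ (b * b) {{m*n≢0 b b}} (begin
  K * N * b ^ N * (b * b)                  ≡⟨ cong (λ e → K * N * e * (b * b)) (^-distribˡ-+-* b j j) ⟩
  K * N * (b ^ j * b ^ j) * (b * b)        ≡⟨ regroup K b (b ^ j) ⟩
  (b ^ j * j) * (b ^ j * j)                ≤⟨ *-mono-≤ half half ⟩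
  (suc b ^ j * b) * (suc b ^ j * b)        ≡⟨ regroup′ (suc b ^ j) b ⟩
  suc b ^ j * suc b ^ j * (b * b)          ≡⟨ cong (_* (b * b)) (^-distribˡ-+-* (suc b) j j) ⟨
  suc b ^ N * (b * b)                      ∎)
  where
  open ≤-Reasoning
  j = 2 * K * (b * b)
  N = j + j
  K≤N : K ≤ N
  K≤N = ≤-trans (m≤n*m K 2) (≤-trans (m≤m*n (2 * K) (b * b) {{m*n≢0 b b}}) (m≤m+n j j))
  half : b ^ j * j ≤ suc b ^ j * b
  half = ≤-trans (*-monoʳ-≤ (b ^ j) (≤-trans (≤-reflexive (sym (*-identityʳ j))) (m≤n+m (j * 1) b)))
    (≤-trans (bernoulli b 1 j) (≤-reflexive (cong (λ c → c ^ j * b) (+-comm b 1))))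
  regroup : ∀ K b e → K * (2 * K * (b * b) + 2 * K * (b * b)) * (e * e) * (b * b)
                    ≡ (e * (2 * K * (b * b))) * (e * (2 * K * (b * b)))
  regroup = solve-∀
  regroup′ : ∀ a b → (a * b) * (a * b) ≡ a * a * (b * b)
  regroup′ = solve-∀

module _ (p Q a : ℕ) where

  private
    s m : ℕ
    s = p * p + p
    m = suc s

  -- (1 − y/x)^Q ≤ 1/(1 + y/x)^Q ≤ 1/(1 + Qy/x) for x = Qm and y = p + 1.
  chernoff-upper : .{{_ : NonZero Q}} → a + suc p ≡ Q * m → a ^ Q * (m + suc p) ≤ (Q * m) ^ Q * m
  chernoff-upper eq = *-cancelʳ-≤ _ _ (x ^ Q * Q) {{m*n≢0 (x ^ Q) Q {{m^n≢0 x Q {{m*n≢0 Q m}}}}}} (begin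
    a ^ Q * (m + y) * (x ^ Q * Q)    ≡⟨ regroup (a ^ Q) m y (x ^ Q) Q ⟩
    a ^ Q * (x ^ Q * (x + Q * y))    ≤⟨ *-monoʳ-≤ (a ^ Q) (bernoulli x y Q) ⟩
    a ^ Q * ((x + y) ^ Q * x)        ≡⟨ *-assoc (a ^ Q) _ x ⟨
    a ^ Q * (x + y) ^ Q * x          ≡⟨ cong (_* x) (^-distribʳ-* Q a (x + y)) ⟨
    (a * (x + y)) ^ Q * x            ≤⟨ *-monoˡ-≤ x (^-monoˡ-≤ Q difference-of-squares) ⟩
    (x * x) ^ Q * x                  ≡⟨ cong (_* x) (^-distribʳ-* Q x x) ⟩
    x ^ Q * x ^ Q * x                ≡⟨ regroup′ (x ^ Q) Q m ⟩
    x ^ Q * m * (x ^ Q * Q)          ∎)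
    where
    open ≤-Reasoning
    y = suc p
    x = Q * m
    regroup : ∀ e m y f Q → e * (m + y) * (f * Q) ≡ e * (f * (Q * m + Q * y))
    regroup = solve-∀
    regroup′ : ∀ f Q m → f * f * (Q * m) ≡ f * m * (f * Q)
    regroup′ = solve-∀
    expand : ∀ a y → a * (a + y + y) + y * y ≡ (a + y) * (a + y)
    expand = solve-∀
    difference-of-squares : a * (x + y) ≤ x * x
    difference-of-squares = begin
      a * (x + y)               ≡⟨ cong (λ z → a * (z + y)) eq ⟨
      a * (a + y + y)           ≤⟨ m≤m+n _ (y * y) ⟩
      a * (a + y + y) + y * y   ≡⟨ expand a y ⟩
      (a + y) * (a + y)         ≡⟨ cong (λ z → z * z) eq ⟩
      x * x                     ∎

  -- The choice m = p² + p + 1 makes (m + p + 1)(m − p) = m² + 1.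
  chernoff-ratio : .{{_ : NonZero Q}} → p ≤ Q → a + suc p ≡ Q * m →
    a ^ Q * suc (m * m) ≤ (Q * s) ^ p * (Q * m) ^ (Q ∸ p) * (m * m)
  chernoff-ratio p≤Q eq = begin
    a ^ Q * suc (m * m)                    ≡⟨ cong (a ^ Q *_) (factor p) ⟨
    a ^ Q * ((m + suc p) * d)              ≡⟨ *-assoc (a ^ Q) (m + suc p) d ⟨
    a ^ Q * (m + suc p) * d                ≤⟨ *-monoˡ-≤ d (chernoff-upper eq) ⟩
    (Q * m) ^ Q * m * d                    ≡⟨ cong (λ e → e * m * d) split ⟩
    Q ^ p * m ^ p * (Q * m) ^ q * m * d    ≡⟨ regroup (Q ^ p) (m ^ p) ((Q * m) ^ q) m d ⟩
    Q ^ p * (Q * m) ^ q * m * (m ^ p * d)  ≤⟨ *-monoʳ-≤ (Q ^ p * (Q * m) ^ q * m) (bernoulli⁻ s p d (m≡p+d p)) ⟩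
    Q ^ p * (Q * m) ^ q * m * (m * s ^ p)  ≡⟨ regroup′ (Q ^ p) ((Q * m) ^ q) m (s ^ p) ⟩
    Q ^ p * s ^ p * (Q * m) ^ q * (m * m)  ≡⟨ cong (λ e → e * (Q * m) ^ q * (m * m)) (^-distribʳ-* p Q s) ⟨
    (Q * s) ^ p * (Q * m) ^ q * (m * m)    ∎
    where
    open ≤-Reasoning
    q = Q ∸ p
    d = suc (p * p)
    factor : ∀ p → (suc (p * p + p) + suc p) * suc (p * p) ≡ suc (suc (p * p + p) * suc (p * p + p))
    factor = solve-∀
    m≡p+d : ∀ p → suc (p * p + p) ≡ p + suc (p * p)
    m≡p+d = solve-∀
    split : (Q * m) ^ Q ≡ Q ^ p * m ^ p * (Q * m) ^ q
    split = trans (cong ((Q * m) ^_) (sym (m+[n∸m]≡n p≤Q))) (trans (^-distribˡ-+-* (Q * m) p q)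
      (cong (_* (Q * m) ^ q) (^-distribʳ-* p Q m)))
    regroup : ∀ a b c m d → a * b * c * m * d ≡ a * c * m * (b * d)
    regroup = solve-∀
    regroup′ : ∀ a b m c → a * b * m * (m * c) ≡ a * c * b * (m * m)
    regroup′ = solve-∀

module _ {n} (G : Graph n) where

  sampleDegree : ∀ {N} → Vec (Fin n) N → Fin n → ℕ
  sampleDegree {N} x v = ∑F N λ j → ⟦ adj G v (lookup x j) ⟧

  module _ (α β : ℕ) where

    -- The product of these weights over a sample replaces the exponential moment of Chernoff's
    -- method: with α below β, each sampled neighbour of `v` lowers it by the factor α/β.
    ω : Fin n → Fin n → ℕ
    ω v u = if adj G v u then α else β

    weight : ∀ {N} → Fin n → Vec (Fin n) N → ℕ
    weight v []      = 1
    weight v (u ∷ x) = ω v u * weight v x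

    -- The weight has one factor α for each sampled neighbour and β otherwise; multiplying by a
    -- power of β avoids the exponent N minus the degree.
    weight-degree : ∀ {N} v (x : Vec (Fin n) N) →
      weight v x * β ^ sampleDegree x v ≡ α ^ sampleDegree x v * β ^ N
    weight-degree v [] = refl
    weight-degree {suc N} v (u ∷ x) rewrite ∑F-suc N {λ j → ⟦ adj G v (lookup (u ∷ x) j) ⟧} with adj G v u
    ... | true  = trans (regroup α β (weight v x) _) (trans (cong (α * β *_) (weight-degree v x)) (regroup′ α β _ _))
      where
      regroup : ∀ a b w e → a * w * (b * e) ≡ a * b * (w * e)
      regroup = solve-∀
      regroup′ : ∀ a b e f → a * b * (e * f) ≡ a * e * (b * f)
      regroup′ = solve-∀
    ... | false = trans (*-assoc β (weight v x) _) (trans (cong (β *_) (weight-degree v x)) (regroup β (α ^ sampleDegree x v) (β ^ N)))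
      where
      regroup : ∀ a b w → a * (b * w) ≡ b * (a * w)
      regroup = solve-∀

    -- As α ≤ β, trading a neighbour for a non-neighbour never lowers the product, so degree exactly
    -- `f` is the extreme case.
    weight-≥ : .{{_ : NonZero β}} → α ≤ β → ∀ f g {N} v (x : Vec (Fin n) N) → N ≡ f + g →
      sampleDegree x v ≤ f → α ^ f * β ^ g ≤ weight v x
    weight-≥ α≤β f g {N} v x N≡f+g e≤f = *-cancelʳ-≤ _ _ (β ^ e) {{m^n≢0 β e}} (begin
      α ^ f * β ^ g * β ^ e                 ≡⟨ cong (λ z → z * β ^ g * β ^ e) (power-split α) ⟩
      α ^ e * α ^ (f ∸ e) * β ^ g * β ^ e   ≤⟨ *-monoˡ-≤ (β ^ e) (*-monoˡ-≤ (β ^ g) (*-monoʳ-≤ (α ^ e) (^-monoˡ-≤ (f ∸ e) α≤β))) ⟩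
      α ^ e * β ^ (f ∸ e) * β ^ g * β ^ e   ≡⟨ regroup (α ^ e) (β ^ (f ∸ e)) (β ^ g) (β ^ e) ⟩
      α ^ e * (β ^ e * β ^ (f ∸ e) * β ^ g) ≡⟨ cong (λ z → α ^ e * (z * β ^ g)) (power-split β) ⟨
      α ^ e * (β ^ f * β ^ g)               ≡⟨ cong (α ^ e *_) (^-distribˡ-+-* β f g) ⟨
      α ^ e * β ^ (f + g)                   ≡⟨ cong (λ N → α ^ e * β ^ N) N≡f+g ⟨
      α ^ e * β ^ N                         ≡⟨ weight-degree v x ⟨
      weight v x * β ^ e                    ∎)
      where
      open ≤-Reasoning
      e = sampleDegree x v
      power-split : ∀ c → c ^ f ≡ c ^ e * c ^ (f ∸ e)
      power-split c = trans (cong (c ^_) (sym (m+[n∸m]≡n e≤f))) (^-distribˡ-+-* c e (f ∸ e))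
      regroup : ∀ a b c d → a * b * c * d ≡ a * (d * b * c)
      regroup = solve-∀

    ∑V-weight : ∀ {T} v → ∑F n (ω v) ≤ T → ∀ N → ∑V n N (weight v) ≤ T ^ N
    ∑V-weight v le zero    = ≤-refl
    ∑V-weight v le (suc N) = ≤-trans (≤-reflexive (trans (∑V-suc n N) (∑-product (allFin n) (vecs (allFin n) N))))
      (*-mono-≤ le (∑V-weight v le N))

    -- The factor T on the left avoids the exponent N − 1 on the right.
    ∑V-selfWeight : ∀ T → (∀ v → ∑F n (ω v) ≤ T) → ∀ N (i : Fin N) →
      T * ∑V n N (λ x → weight (lookup x i) x) ≤ n * β * T ^ N
    ∑V-selfWeight T le (suc N) zero = begin
      T * ∑V n (suc N) (λ x → weight (lookup x zero) x)    ≡⟨ cong (T *_) (∑V-suc n N) ⟩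
      T * ∑F n (λ v → ∑V n N (λ y → ω v v * weight v y))   ≤⟨ *-monoʳ-≤ T (∑-mono (allFin n) head≤) ⟩
      T * ∑F n (λ v → β * T ^ N)                           ≡⟨ cong (T *_) (∑F-const n _) ⟩
      T * (n * (β * T ^ N))                                ≡⟨ regroup T n β (T ^ N) ⟩
      n * β * T ^ suc N                                    ∎
      where
      open ≤-Reasoning
      -- The sampled vertex is not its own neighbour, so its own position contributes β instead of
      -- the average that `T` bounds.
      ω-self : ∀ v → ω v v ≡ β
      ω-self v = cong (λ b → if b then α else β) (irrefl G v)
      head≤ : ∀ v → ∑V n N (λ y → ω v v * weight v y) ≤ β * T ^ N
      head≤ v = ≤-trans (≤-reflexive (∑-*ˡ (vecs (allFin n) N) (ω v v)))
        (*-mono-≤ (≤-reflexive (ω-self v)) (∑V-weight v (le v) N))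
      regroup : ∀ t n b e → t * (n * (b * e)) ≡ n * b * (t * e)
      regroup = solve-∀
    ∑V-selfWeight T le (suc N) (suc i) = begin
      T * ∑V n (suc N) (λ x → weight (lookup x (suc i)) x)
        ≡⟨ cong (T *_) (trans (∑V-suc n N) (∑-swap (allFin n) Vs)) ⟩
      T * ∑V n N (λ y → ∑F n (λ v → ω (lookup y i) v * weight (lookup y i) y))
        ≤⟨ *-monoʳ-≤ T (∑-mono Vs λ y → ≤-trans (≤-reflexive (∑-*ʳ (allFin n) (weight (lookup y i) y))) (*-monoˡ-≤ _ (le (lookup y i)))) ⟩
      T * ∑V n N (λ y → T * weight (lookup y i) y)
        ≡⟨ cong (T *_) (∑-*ˡ Vs T) ⟩
      T * (T * ∑V n N (λ y → weight (lookup y i) y))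
        ≤⟨ *-monoʳ-≤ T (∑V-selfWeight T le N i) ⟩
      T * (n * β * T ^ N)
        ≡⟨ regroup T (n * β) (T ^ N) ⟩
      n * β * T ^ suc N ∎
      where
      open ≤-Reasoning
      Vs = vecs (allFin n) N
      regroup : ∀ t b e → t * (b * e) ≡ b * (t * e)
      regroup = solve-∀

  deg≤n : ∀ v → deg G v ≤ n
  deg≤n v = ≤-trans (∑-mono (allFin n) λ u → ⟦⟧≤1 (adj G v u)) (≤-reflexive (trans (∑F-const n 1) (*-identityʳ n)))

  lowDegree : ℕ → ℕ → ∀ {N} → Vec (Fin n) N → Fin N → ℕ
  lowDegree p Q {N} x i = ⟦ does (Q * sampleDegree x (lookup x i) <? p * N) ⟧

  -- Markov's inequality for the weight of the vertex at position `i`. The slack between `suc p` in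
  -- the hypothesis and `p` in `lowDegree` yields a decay factor b/(b + 1) for each of the `R`
  -- groups of `Q` positions. For `p = 0` no degree is too low.
  low-degree-rare : ∀ p Q .{{_ : NonZero n}} .{{_ : NonZero Q}} →
    p ≡ 0 ⊎ (∀ v → suc p * n ≤ Q * deg G v) → ∀ R (i : Fin (Q * R)) → let b = suc (p * p + p) * suc (p * p + p) in
    ∑V n (Q * R) (λ x → lowDegree p Q x i) * suc b ^ R ≤ 2 * n ^ (Q * R) * b ^ R
  low-degree-rare zero Q _ R i = ≤-trans (≤-reflexive (cong (_* 2 ^ R)
      (trans (∑V-const n (Q * R) 0) (*-zeroʳ (n ^ (Q * R))))))
    z≤n
  low-degree-rare (suc _) Q (inj₁ ()) R i
  low-degree-rare p@(suc p-1) Q (inj₂ minDeg) R i = *-cancelʳ-≤ _ _ (Z ^ R) {{m^n≢0 Z R {{Z≢0}}}} (begin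
    count * suc b ^ R * Z ^ R               ≡⟨ regroup count (suc b ^ R) (Z ^ R) ⟩
    count * Z ^ R * suc b ^ R               ≤⟨ *-monoˡ-≤ (suc b ^ R) (≤-trans markov total) ⟩
    2 * T ^ N * suc b ^ R                   ≡⟨ cong (λ e → 2 * e * suc b ^ R) (trans (^-distribʳ-* N n a) (cong (n ^ N *_) (sym (^-*-assoc a Q R)))) ⟩
    2 * (n ^ N * (a ^ Q) ^ R) * suc b ^ R   ≡⟨ regroup′ (n ^ N) ((a ^ Q) ^ R) (suc b ^ R) ⟩
    2 * n ^ N * ((a ^ Q) ^ R * suc b ^ R)   ≡⟨ cong (2 * n ^ N *_) (^-distribʳ-* R (a ^ Q) (suc b)) ⟨
    2 * n ^ N * (a ^ Q * suc b) ^ R         ≤⟨ *-monoʳ-≤ (2 * n ^ N) (^-monoˡ-≤ R (chernoff-ratio p Q a p≤Q a+1+p≡β)) ⟩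
    2 * n ^ N * (Z * b) ^ R                 ≡⟨ cong (2 * n ^ N *_) (trans (^-distribʳ-* R Z b) (*-comm (Z ^ R) (b ^ R))) ⟩
    2 * n ^ N * (b ^ R * Z ^ R)             ≡⟨ *-assoc (2 * n ^ N) (b ^ R) (Z ^ R) ⟨
    2 * n ^ N * b ^ R * Z ^ R               ∎)
    where
    open ≤-Reasoning
    s = p * p + p
    m = suc s
    b = m * m
    N = Q * R
    α = Q * s
    β = Q * m
    -- Bounds the mean of `ω`: each neighbour costs `Q` out of β, and at least (p + 1)n/Q of the `n`
    -- vertices are neighbours.
    a = β ∸ suc p
    T = n * a
    -- `Z ^ R` is the weight of a sample containing exactly `p * R` neighbours, the threshold for
    -- low degree.
    Z = α ^ p * β ^ (Q ∸ p)
    instance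
      β≢0 : NonZero β
      β≢0 = m*n≢0 Q m
    count = ∑V n N (λ x → lowDegree p Q x i)
    Z≢0 : NonZero Z
    Z≢0 = m*n≢0 (α ^ p) (β ^ (Q ∸ p)) {{m^n≢0 α p {{m*n≢0 Q s}}}} {{m^n≢0 β (Q ∸ p)}}
    regroup : ∀ a b c → a * b * c ≡ a * c * b
    regroup = solve-∀
    regroup′ : ∀ a b c → 2 * (a * b) * c ≡ 2 * a * (b * c)
    regroup′ = solve-∀
    someVertex : ∀ {n} .{{_ : NonZero n}} → Fin n
    someVertex {suc n} = zero
    1+p≤Q : suc p ≤ Q
    1+p≤Q = *-cancelʳ-≤ (suc p) Q n (≤-trans (minDeg someVertex) (*-monoʳ-≤ Q (deg≤n someVertex)))
    p≤Q : p ≤ Q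
    p≤Q = <⇒≤ 1+p≤Q
    1+p≤β : suc p ≤ β
    1+p≤β = ≤-trans 1+p≤Q (m≤m*n Q m)
    a+1+p≡β : a + suc p ≡ β
    a+1+p≡β = m∸n+n≡m 1+p≤β
    -- Gives β ≤ 2a, which is the origin of the factor 2 in the bound.
    1+p≤a : suc p ≤ a
    1+p≤a = +-cancelʳ-≤ (suc p) (suc p) a (begin
      suc p + suc p   ≡⟨ double (suc p) ⟩
      suc p * 2       ≤⟨ *-mono-≤ 1+p≤Q (s≤s (≤-trans (s≤s z≤n) (m≤n+m p (p * p)))) ⟩
      β               ≡⟨ a+1+p≡β ⟨
      a + suc p       ∎)
      where
      double : ∀ a → a + a ≡ a * 2
      double = solve-∀
    T≢0 : NonZero T
    T≢0 = m*n≢0 n a {{it}} {{>-nonZero (≤-trans (s≤s z≤n) 1+p≤a)}}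
    ∑ω≤T : ∀ v → ∑F n (ω α β v) ≤ T
    ∑ω≤T v = +-cancelʳ-≤ (suc p * n) _ T (begin
      ∑F n (ω α β v) + suc p * n      ≤⟨ +-monoʳ-≤ _ (minDeg v) ⟩
      ∑F n (ω α β v) + Q * deg G v    ≡⟨ cong (∑F n (ω α β v) +_) (∑-*ˡ (allFin n) Q) ⟨
      ∑F n (ω α β v) + ∑F n (λ u → Q * ⟦ adj G v u ⟧) ≡⟨ ∑-+ (allFin n) ⟨
      ∑F n (λ u → ω α β v u + Q * ⟦ adj G v u ⟧)      ≡⟨ ∑-cong (allFin n) pointwise ⟩
      ∑F n (λ _ → β)                  ≡⟨ ∑F-const n β ⟩
      n * β                           ≡⟨ cong (n *_) a+1+p≡β ⟨
      n * (a + suc p)                 ≡⟨ regroup″ n a (suc p) ⟩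
      T + suc p * n                   ∎)
      where
      regroup″ : ∀ n a b → n * (a + b) ≡ n * a + b * n
      regroup″ = solve-∀
      pointwise : ∀ u → ω α β v u + Q * ⟦ adj G v u ⟧ ≡ β
      pointwise u with adj G v u
      ... | true  = trans (+-comm (Q * s) (Q * 1)) (sym (*-distribˡ-+ Q 1 s))
      ... | false = trans (cong (β +_) (*-zeroʳ Q)) (+-identityʳ β)
    S = ∑V n N (λ x → weight α β (lookup x i) x)
    total : S ≤ 2 * T ^ N
    total = *-cancelˡ-≤ T {{T≢0}} (begin
      T * S                  ≤⟨ ∑V-selfWeight α β T ∑ω≤T N i ⟩
      n * β * T ^ N          ≤⟨ *-monoˡ-≤ (T ^ N) (*-monoʳ-≤ n (≤-trans (≤-reflexive (sym a+1+p≡β)) (+-monoʳ-≤ a 1+p≤a))) ⟩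
      n * (a + a) * T ^ N    ≡⟨ regroup″ n a (T ^ N) ⟩
      T * (2 * T ^ N)        ∎)
      where
      regroup″ : ∀ n a e → n * (a + a) * e ≡ n * a * (2 * e)
      regroup″ = solve-∀
    markov : count * Z ^ R ≤ S
    markov = ≤-trans (≤-reflexive (sym (∑-*ʳ (vecs (allFin n) N) (Z ^ R)))) (∑-mono (vecs (allFin n) N) pointwise)
      where
      power : Z ^ R ≡ α ^ (p * R) * β ^ ((Q ∸ p) * R)
      power = trans (^-distribʳ-* R (α ^ p) (β ^ (Q ∸ p))) (cong₂ _*_ (^-*-assoc α p R) (^-*-assoc β (Q ∸ p) R))
      N-split : N ≡ p * R + (Q ∸ p) * R
      N-split = trans (cong (_* R) (sym (m+[n∸m]≡n p≤Q))) (*-distribʳ-+ R p (Q ∸ p))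
      swap : ∀ p Q R → p * (Q * R) ≡ Q * (p * R)
      swap = solve-∀
      pointwise : ∀ x → lowDegree p Q x i * Z ^ R ≤ weight α β (lookup x i) x
      pointwise x = ⟦does⟧*≤ (Q * sampleDegree x (lookup x i) <? p * N) λ lt → ≤-trans (≤-reflexive power)
        (weight-≥ α β (*-monoʳ-≤ Q (n≤1+n s)) (p * R) ((Q ∸ p) * R) (lookup x i) x N-split
          (<⇒≤ (*-cancelˡ-< Q _ _ (<-≤-trans lt (≤-reflexive (swap p Q R))))))

-- Samples of a graph far from k-colourable

-- A prefix of a uniform tuple is uniform; cross-multiplying avoids the exponent N - M.
∑V-truncate : ∀ n {M N} (M≤N : M ≤ N) (f : Vec (Fin n) M → ℕ) →
  ∑V n N (f ∘ truncate M≤N) * n ^ M ≡ n ^ N * ∑V n M f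
∑V-truncate n {N = N} z≤n f = trans (*-identityʳ _) (trans (∑V-const n N (f [])) (cong (n ^ N *_) (sym (+-identityʳ (f [])))))
∑V-truncate n {suc M} {suc N} (s≤s M≤N) f = begin
  ∑V n (suc N) (f ∘ truncate (s≤s M≤N)) * (n * n ^ M)    ≡⟨ cong (_* (n * n ^ M)) (∑V-suc n N) ⟩
  ∑F n S * (n * n ^ M)                                   ≡⟨ regroup (∑F n S) n (n ^ M) ⟩
  n * (∑F n S * n ^ M)                                   ≡⟨ cong (n *_) (∑-*ʳ (allFin n) (n ^ M)) ⟨
  n * ∑F n (λ v → S v * n ^ M)                           ≡⟨ cong (n *_) (∑-cong (allFin n) λ v → ∑V-truncate n M≤N (λ x → f (v ∷ x))) ⟩
  n * ∑F n (λ v → n ^ N * ∑V n M (λ x → f (v ∷ x)))      ≡⟨ cong (n *_) (∑-*ˡ (allFin n) (n ^ N)) ⟩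
  n * (n ^ N * ∑F n (λ v → ∑V n M (λ x → f (v ∷ x))))    ≡⟨ *-assoc n (n ^ N) _ ⟨
  n * n ^ N * ∑F n (λ v → ∑V n M (λ x → f (v ∷ x)))      ≡⟨ cong (n * n ^ N *_) (∑V-suc n M) ⟨
  n * n ^ N * ∑V n (suc M) f                             ∎
  where
  open ≡-Reasoning
  S : Fin n → ℕ
  S v = ∑V n N (λ x → f (v ∷ truncate M≤N x))
  regroup : ∀ a b c → a * (b * c) ≡ b * (a * c)
  regroup = solve-∀

-- Sampling is with replacement: equal entries become non-adjacent twins, so a sample maps
-- homomorphically to `G` without having to be a subgraph.
sample : ∀ {n N} → Graph n → Vec (Fin n) N → Graph N
sample G x = record
  { adj    = λ i j → adj G (lookup x i) (lookup x j)
  ; sym    = λ i j → adj-sym G (lookup x i) (lookup x j)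
  ; irrefl = λ i → irrefl G (lookup x i)
  }

module _ {h} (H : Graph h) (k p Q D : ℕ) .{{Q≢0 : NonZero Q}} .{{D≢0 : NonZero D}} (i₀ : Fin k)
  (homProfile : ∀ N (F : Graph N) → ¬ Hom H F → (∀ v → p * N ≤ Q * deg F v) → Colourable k F) where

  private
    t M C m b K R N : ℕ
    -- Full lists have `n * k` entries, so this is a budget just above the `D * k` units that they
    -- amount to.
    t = suc (D * k)
    M = trials k t
    C = cost k D t
    m = suc (p * p + p)
    b = m * m
    -- With `8 * Q * C`, a union bound over the `Q * R` positions leaves low degrees a density of at
    -- most 1/(4C); the summand `M` makes the sample long enough to contain a refutation.
    K = 8 * Q * C + M
    R = proj₁ (beats-linear b K)
    -- A multiple of `Q`, so that the fraction p/Q of N is the integer `p * R`.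
    N = Q * R

    instance
      C≢0 : NonZero C
      C≢0 = cost≢0 k D t
      8QC≢0 : NonZero (8 * Q * C)
      8QC≢0 = m*n≢0 (8 * Q) C {{m*n≢0 8 Q}}

    K≤R : K ≤ R
    K≤R = proj₁ (proj₂ (beats-linear b K))

    instance
      R≢0 : NonZero R
      R≢0 = >-nonZero (≤-trans (>-nonZero⁻¹ (8 * Q * C)) (≤-trans (m≤m+n _ M) K≤R))
      N≢0 : NonZero N
      N≢0 = m*n≢0 Q R
      4C≢0 : NonZero (4 * C)
      4C≢0 = m*n≢0 4 C

    M≤N : M ≤ N
    M≤N = ≤-trans (m≤n+m M (8 * Q * C)) (≤-trans K≤R (m≤n*m R Q))

    threshold : ℕ
    -- What `few-homs` requires for density 1/(4C N^h); there are N^h maps from `H` to the sample.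
    threshold = suc (squarings (4 * C * N ^ h) h * ((h + N) * (h + N)))

  module _ {n} (G : Graph n) (large : n ≥ threshold) (free : Free H G)
           (minDeg : p ≡ 0 ⊎ (∀ v → suc p * n ≤ Q * deg G v)) where

    private
      instance
        n≢0 : NonZero n
        n≢0 = >-nonZero (≤-trans (s≤s z≤n) large)

      Vs = vecs (allFin n) N
      everything : Lists G k D
      everything _ _ = true

      refuting lowDegrees homs : Vec (Fin n) N → ℕ
      refuting x   = refutes G k D t everything (truncate M≤N x)
      lowDegrees x = ∑F N (lowDegree G p Q x)
      homs x       = ∑V N h (λ φ → homIndicator H G (lookup φ) x)

      few-lowDegrees : 4 * C * ∑V n N lowDegrees ≤ n ^ N
      few-lowDegrees = *-cancelˡ-≤ (2 * N) {{m*n≢0 2 N}} (begin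
        2 * N * (4 * C * ∑V n N lowDegrees)            ≡⟨ cong (λ s → 2 * N * (4 * C * s)) (∑-swap Vs (allFin N)) ⟩
        2 * N * (4 * C * ∑F N count)                   ≡⟨ regroup Q R C (∑F N count) ⟩
        ∑F N count * (8 * Q * C * R)                   ≡⟨ ∑-*ʳ (allFin N) (8 * Q * C * R) ⟨
        ∑F N (λ i → count i * (8 * Q * C * R))         ≤⟨ ∑-mono (allFin N) each ⟩
        ∑F N (λ _ → 2 * n ^ N)                         ≡⟨ ∑F-const N _ ⟩
        N * (2 * n ^ N)                                ≡⟨ regroup′ N (n ^ N) ⟩
        2 * N * n ^ N                                  ∎)
        where
        open ≤-Reasoning
        count : Fin N → ℕ
        count i = ∑V n N (λ x → lowDegree G p Q x i)
        each : ∀ i → count i * (8 * Q * C * R) ≤ 2 * n ^ N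
        each i = *-cancelʳ-≤ _ _ (b ^ R) {{m^n≢0 b R}} (begin
          count i * (8 * Q * C * R) * b ^ R    ≡⟨ *-assoc (count i) _ (b ^ R) ⟩
          count i * (8 * Q * C * R * b ^ R)    ≤⟨ *-monoʳ-≤ (count i) (*-monoˡ-≤ (b ^ R) (*-monoˡ-≤ R (m≤m+n (8 * Q * C) M))) ⟩
          count i * (K * R * b ^ R)            ≤⟨ *-monoʳ-≤ (count i) (proj₂ (proj₂ (beats-linear b K))) ⟩
          count i * suc b ^ R                  ≤⟨ low-degree-rare G p Q minDeg R i ⟩
          2 * n ^ N * b ^ R                    ∎)
        regroup : ∀ Q R C s → 2 * (Q * R) * (4 * C * s) ≡ s * (8 * Q * C * R)
        regroup = solve-∀
        regroup′ : ∀ a b → a * (2 * b) ≡ 2 * a * b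
        regroup′ = solve-∀

      few-homs′ : 4 * C * ∑V n N homs ≤ n ^ N
      few-homs′ = *-cancelˡ-≤ (N ^ h) {{m^n≢0 N h}} (begin
        N ^ h * (4 * C * ∑V n N homs)                  ≡⟨ cong (λ s → N ^ h * (4 * C * s)) (∑-swap Vs Φ) ⟩
        N ^ h * (4 * C * ∑V N h X)                     ≡⟨ regroup (N ^ h) (4 * C) (∑V N h X) ⟩
        4 * C * N ^ h * ∑V N h X                       ≡⟨ ∑-*ˡ Φ (4 * C * N ^ h) ⟨
        ∑V N h (λ φ → 4 * C * N ^ h * X φ)             ≤⟨ ∑-mono Φ (λ φ → few-homs H G free N (4 * C * N ^ h) large (lookup φ)) ⟩
        ∑V N h (λ _ → n ^ N)                           ≡⟨ ∑V-const N h (n ^ N) ⟩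
        N ^ h * n ^ N                                  ∎)
        where
        open ≤-Reasoning
        Φ = vecs (allFin N) h
        X : Vec (Fin N) h → ℕ
        X φ = homCount H G N (lookup φ)
        regroup : ∀ a b c → a * (b * c) ≡ b * a * c
        regroup = solve-∀

      -- Without either failure the sample has the minimum degree that `homProfile` asks for and
      -- admits no homomorphism from `H`, so it is `k`-colourable; restricting the colouring to the
      -- first `M` positions contradicts `refutes-sound`.
      refuting-impossible : ∀ x → lowDegrees x + homs x ≡ 0 → refuting x ≡ 0
      refuting-impossible x none with refuting x ≟ 0
      ... | yes ≡0 = ≡0
      ... | no ≢0 with homProfile N (sample G x) ¬hom degrees
        where
        ¬hom : ¬ Hom H (sample G x)
        ¬hom (φ , hom) = contradiction (begin
          1                                              ≡⟨ ⟦does⟧-yes (isHom? H G (lookup x ∘ lookup (tabulate φ))) hom′ ⟨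
          homIndicator H G (lookup (tabulate φ)) x       ≤⟨ ∑V-term (tabulate φ) ⟩
          homs x                                         ≡⟨ m+n≡0⇒n≡0 (lowDegrees x) none ⟩
          0                                              ∎) λ ()
          where
          open ≤-Reasoning
          hom′ : ∀ a b → adj H a b ≡ true →
            adj G (lookup x (lookup (tabulate φ) a)) (lookup x (lookup (tabulate φ) b)) ≡ true
          hom′ a b ab = subst₂ (λ c d → adj G (lookup x c) (lookup x d) ≡ true)
            (sym (lookup∘tabulate φ a)) (sym (lookup∘tabulate φ b)) (hom a b ab)
        degrees : ∀ v → p * N ≤ Q * deg (sample G x) v
        degrees v = ≮⇒≥ λ lt → contradiction (begin
          1                         ≡⟨ ⟦does⟧-yes (Q * sampleDegree G x (lookup x v) <? p * N) lt ⟨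
          lowDegree G p Q x v       ≤⟨ ∑F-term v ⟩
          lowDegrees x              ≡⟨ m+n≡0⇒m≡0 (lowDegrees x) none ⟩
          0                         ∎) λ ()
          where open ≤-Reasoning
      ... | f , proper = ⊥-elim (refutes-sound G k D t everything (truncate M≤N x) ≢0
              (λ i → f (inject≤ i M≤N)) (λ _ → refl)
              (λ i j ij → proper (inject≤ i M≤N) (inject≤ j M≤N)
                (subst₂ (λ v w → adj G v w ≡ true) (lookup-truncate M≤N x i) (lookup-truncate M≤N x j) ij)))

      -- Refuting samples would have density at least 1/C, while the two kinds of failure together
      -- contribute at most 1/(2C) on average. Some sample would then have fewer failures than
      -- `refuting`, which is at most 1: it refutes and has none.
      ¬dense : ¬ (n ^ M ≤ C * ∑V n M (refutes G k D t everything))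
      ¬dense dense = contradiction (refuting-impossible x (n<1⇒n≡0 (<-≤-trans x-good (refutes≤1 G k D t everything (truncate M≤N x)))))
        (λ ≡0 → n≮0 (<-≤-trans x-good (≤-reflexive ≡0)))
        where
        open ≤-Reasoning
        S = ∑V n N refuting
        many : n ^ N ≤ C * S
        many = *-cancelʳ-≤ _ _ (n ^ M) {{m^n≢0 n M}} (begin
          n ^ N * n ^ M                                           ≤⟨ *-monoʳ-≤ (n ^ N) dense ⟩
          n ^ N * (C * ∑V n M (refutes G k D t everything))       ≡⟨ regroup (n ^ N) C _ ⟩
          C * (n ^ N * ∑V n M (refutes G k D t everything))       ≡⟨ cong (C *_) (∑V-truncate n M≤N (refutes G k D t everything)) ⟨
          C * (S * n ^ M)                                         ≡⟨ *-assoc C S (n ^ M) ⟨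
          C * S * n ^ M                                           ∎)
          where
          regroup : ∀ a b c → a * (b * c) ≡ b * (a * c)
          regroup = solve-∀
        fewer : ∑V n N (λ x → lowDegrees x + homs x) < S
        fewer = *-cancelˡ-< (4 * C) _ _ (begin-strict
          4 * C * ∑V n N (λ x → lowDegrees x + homs x)             ≡⟨ cong (4 * C *_) (∑-+ Vs) ⟩
          4 * C * (∑V n N lowDegrees + ∑V n N homs)                ≡⟨ *-distribˡ-+ (4 * C) _ _ ⟩
          4 * C * ∑V n N lowDegrees + 4 * C * ∑V n N homs          ≤⟨ +-mono-≤ few-lowDegrees few-homs′ ⟩
          n ^ N + n ^ N                                            <⟨ +-monoʳ-< (n ^ N) (m<m+n (n ^ N) (≤-trans (m^n>0 n N) (m≤m+n (n ^ N) _))) ⟩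
          4 * n ^ N                                                ≤⟨ *-monoʳ-≤ 4 many ⟩
          4 * (C * S)                                              ≡⟨ *-assoc 4 C S ⟨
          4 * C * S                                                ∎)
        x = proj₁ (∑-<⇒∃ Vs fewer)
        x-good : lowDegrees x + homs x < refuting x
        x-good = proj₂ (∑-<⇒∃ Vs fewer)

      D*size<t*n : D * size G k D everything < t * n
      D*size<t*n = begin-strict
        D * size G k D everything ≡⟨ cong (D *_) (trans (∑-cong (allFin n) λ _ → trans (∑F-const k 1) (*-identityʳ k)) (∑F-const n k)) ⟩
        D * (n * k)               ≡⟨ regroup D n k ⟩
        D * k * n                 <⟨ m<n+m (D * k * n) (>-nonZero⁻¹ n) ⟩
        t * n                     ∎
        where
        open ≤-Reasoning
        regroup : ∀ a b c → a * (b * c) ≡ a * c * b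
        regroup = solve-∀

    close : Close G k D
    close with many-refutes G k D i₀ t everything D*size<t*n
    ... | inj₁ c     = c
    ... | inj₂ dense = ⊥-elim (¬dense dense)

  homProfile⇒close : ∃ λ n₀ → ∀ n (G : Graph n) → n ≥ n₀ → Free H G →
    p ≡ 0 ⊎ (∀ v → suc p * n ≤ Q * deg G v) → Close G k D
  homProfile⇒close = threshold , λ n G → close G

-- Blow-ups

blowup : ∀ {n} → Graph n → ∀ t → Graph (n * t)
blowup G t = record
  { adj    = λ x y → adj G (quotient t x) (quotient t y)
  ; sym    = λ x y → adj-sym G _ _
  ; irrefl = λ x → irrefl G _
  }

quotient-combine : ∀ {n t} (u : Fin n) (i : Fin t) → quotient t (combine u i) ≡ u
quotient-combine u i = cong proj₁ (Fin.remQuot-combine u i)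

∑F-quotient : ∀ n t (f : Fin n → ℕ) → ∑F (n * t) (f ∘ quotient t) ≡ t * ∑F n f
∑F-quotient n t f = trans (∑F-* n t) (trans (∑-cong (allFin n) λ u →
  trans (∑-cong (allFin t) λ i → cong f (quotient-combine u i)) (∑F-const t (f u))) (∑-*ˡ (allFin n) t))

-- Needed because `edges` counts a pair only in increasing order, so the order of the blocks must
-- carry over to their vertices.
quotient-cancel-< : ∀ n t (x y : Fin (n * t)) → toℕ (quotient {n} t x) < toℕ (quotient {n} t y) → toℕ x < toℕ y
quotient-cancel-< n t x y lt =
  subst₂ (λ a b → toℕ a < toℕ b) (Fin.combine-remQuot {n} t x) (Fin.combine-remQuot {n} t y)
    (Fin.combine-monoˡ-< (proj₂ (remQuot {n} t x)) (proj₂ (remQuot {n} t y)) lt)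

deg-blowup : ∀ {n} (G : Graph n) t x → deg (blowup G t) x ≡ t * deg G (quotient t x)
deg-blowup {n} G t x = ∑F-quotient n t (λ w → ⟦ adj G (quotient t x) w ⟧)

module _ {n} (G : Graph n) (t k : ℕ) .{{_ : NonZero t}} .{{_ : NonZero k}}
  (G′ : Graph (n * t)) (G′⊆ : SpanningSubgraph G′ (blowup G t))
  (f : Fin (n * t) → Fin k) (proper : ∀ x y → adj G′ x y ≡ true → f x ≢ f y) where

  private
    member : Fin n → Fin k → Fin (n * t) → ℕ
    member u c x = ⟦ does (u Fin.≟ quotient t x) ⟧ * ⟦ does (f x Fin.≟ c) ⟧

    class : Fin n → Fin k → ℕ
    class u c = ∑F (n * t) (member u c)

    ∑-class : ∀ u → ∑F k (class u) ≡ t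
    ∑-class u = begin
      ∑F k (class u)                                                       ≡⟨ ∑-swap (allFin k) (allFin (n * t)) ⟩
      ∑F (n * t) (λ x → ∑F k (λ c → member u c x))                         ≡⟨ ∑-cong (allFin (n * t)) ∑-member ⟩
      ∑F (n * t) (λ x → ⟦ does (u Fin.≟ quotient t x) ⟧)                   ≡⟨ ∑F-quotient n t (λ w → ⟦ does (u Fin.≟ w) ⟧) ⟩
      t * ∑F n (λ w → ⟦ does (u Fin.≟ w) ⟧)                                ≡⟨ cong (t *_) (∑F-δ u) ⟩
      t * 1                                                                ≡⟨ *-identityʳ t ⟩
      t                                                                    ∎
      where
      open ≡-Reasoning
      ∑-member : ∀ x → ∑F k (λ c → member u c x) ≡ ⟦ does (u Fin.≟ quotient t x) ⟧
      ∑-member x = trans (∑-*ˡ (allFin k) δ) (trans (cong (δ *_) (∑F-δ (f x))) (*-identityʳ δ))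
        where δ = ⟦ does (u Fin.≟ quotient t x) ⟧

    -- Averaging over the `k` colours in a block of size `t`. The added 1 makes the comparison of
    -- sums strict, as `∑-<⇒∃` requires.
    majority : ∀ u → ∃ λ c → t < suc (k * class u c)
    majority u = ∑-<⇒∃ (allFin k) (begin-strict
      ∑F k (λ _ → t)                     ≡⟨ ∑F-const k t ⟩
      k * t                              <⟨ m<n+m (k * t) (>-nonZero⁻¹ k) ⟩
      k + k * t                          ≡⟨ cong₂ _+_ (trans (∑F-const k 1) (*-identityʳ k))
                                             (trans (∑-*ˡ (allFin k) k) (cong (k *_) (∑-class u))) ⟨
      ∑F k (λ _ → 1) + ∑F k (λ c → k * class u c) ≡⟨ ∑-+ (allFin k) ⟨
      ∑F k (λ c → suc (k * class u c))   ∎)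
      where open ≤-Reasoning

    -- The blow-up joins block `u` completely to block `v`, but `G′` has no edge between two
    -- vertices of colour `c`. The condition `toℕ u < toℕ v` puts each lost pair into the order in
    -- which `edges` counts it.
    deleted : ∀ {u v} → adj G u v ≡ true → toℕ u < toℕ v → ∀ c →
      edges G′ + class u c * class v c ≤ edges (blowup G t)
    deleted {u} {v} uv u<v c = begin
      edges G′ + class u c * class v c
        ≡⟨ cong (edges G′ +_) (∑-product Xs Xs) ⟨
      edges G′ + ∑ Xs (λ x → ∑ Xs (λ y → member u c x * member v c y))
        ≡⟨ trans (∑-cong Xs λ x → ∑-+ Xs) (∑-+ Xs) ⟨
      ∑ Xs (λ x → ∑ Xs (λ y → ⟦ adj G′ x y ∧ (toℕ x <ᵇ toℕ y) ⟧ + member u c x * member v c y))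
        ≤⟨ ∑-mono Xs (λ x → ∑-mono Xs (pointwise x)) ⟩
      edges (blowup G t) ∎
      where
      open ≤-Reasoning
      Xs = allFin (n * t)
      subgraph : ∀ x y b → ⟦ adj G′ x y ∧ b ⟧ + 0 ≤ ⟦ adj (blowup G t) x y ∧ b ⟧
      subgraph x y b with adj G′ x y in e
      ... | false = z≤n
      ... | true rewrite G′⊆ x y e = ≤-reflexive (+-identityʳ _)
      pointwise : ∀ x y → ⟦ adj G′ x y ∧ (toℕ x <ᵇ toℕ y) ⟧ + member u c x * member v c y ≤
                          ⟦ adj (blowup G t) x y ∧ (toℕ x <ᵇ toℕ y) ⟧
      pointwise x y with u Fin.≟ quotient t x | f x Fin.≟ c | v Fin.≟ quotient t y | f y Fin.≟ c
      ... | no _  | _     | _     | _     = subgraph x y _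
      ... | yes _ | no _  | _     | _     = subgraph x y _
      ... | yes _ | yes _ | no _  | _     = subgraph x y _
      ... | yes _ | yes _ | yes _ | no _  = subgraph x y _
      ... | yes refl | yes fx | yes refl | yes fy
        rewrite uv | dec-true (toℕ x <? toℕ y) (quotient-cancel-< n t x y u<v) with adj G′ x y in e
      ...   | false = ≤-refl
      ...   | true  = contradiction (trans fx (sym fy)) (proper x y e)

  -- If both ends of an edge had majority colour `c`, at least t²/k² edges would be deleted. The
  -- allowance (nt)²/(k²n² + 1) is strictly smaller because of the `suc`.
  few-deleted⇒Colourable :
    suc (k * k * (n * n)) * (edges (blowup G t) ∸ edges G′) ≤ n * t * (n * t) → Colourable k G
  few-deleted⇒Colourable few = g , g-proper
    where
    g : Fin n → Fin k
    g u = proj₁ (majority u)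
    ordered : ∀ u v → toℕ u < toℕ v → adj G u v ≡ true → g u ≢ g v
    ordered u v u<v uv gu≡gv = contradiction (begin-strict
      e * (t * t)                                  <⟨ m<n+m (e * (t * t)) (>-nonZero⁻¹ (t * t) {{m*n≢0 t t}}) ⟩
      suc e * (t * t)                              ≤⟨ *-monoʳ-≤ (suc e) (*-mono-≤ t≤u t≤v) ⟩
      suc e * (k * class u c * (k * class v c))    ≡⟨ regroup (suc e) k (class u c) (class v c) ⟩
      k * k * (suc e * (class u c * class v c))    ≤⟨ *-monoʳ-≤ (k * k) (*-monoʳ-≤ (suc e) (m+n≤o⇒n≤o∸m _ (deleted uv u<v c))) ⟩
      k * k * (suc e * (edges (blowup G t) ∸ edges G′)) ≤⟨ *-monoʳ-≤ (k * k) few ⟩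
      k * k * (n * t * (n * t))                    ≡⟨ regroup′ k n t ⟩
      e * (t * t)                                  ∎) (<-irrefl refl)
      where
      open ≤-Reasoning
      e = k * k * (n * n)
      c = g u
      t≤u : t ≤ k * class u c
      t≤u = s≤s⁻¹ (proj₂ (majority u))
      t≤v : t ≤ k * class v c
      t≤v = subst (λ c → t ≤ k * class v c) (sym gu≡gv) (s≤s⁻¹ (proj₂ (majority v)))
      m+n≤o⇒n≤o∸m : ∀ m {n o} → m + n ≤ o → n ≤ o ∸ m
      m+n≤o⇒n≤o∸m m {n} le = m+n≤o⇒m≤o∸n n (≤-trans (≤-reflexive (+-comm n m)) le)
      regroup : ∀ e k a b → e * (k * a * (k * b)) ≡ k * k * (e * (a * b))
      regroup = solve-∀
      regroup′ : ∀ k n t → k * k * (n * t * (n * t)) ≡ k * k * (n * n) * (t * t)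
      regroup′ = solve-∀
    g-proper : ∀ u v → adj G u v ≡ true → g u ≢ g v
    g-proper u v uv gu≡gv with <-cmp (toℕ u) (toℕ v)
    ... | tri< u<v _ _ = ordered u v u<v uv gu≡gv
    ... | tri≈ _ u≡v _ = contradiction (trans (sym uv) (trans (cong (adj G u) (sym (Fin.toℕ-injective u≡v))) (irrefl G u))) λ ()
    ... | tri> _ _ v<u = ordered v u v<u (trans (adj-sym G v u) uv) (sym gu≡gv)

-- Deleting the monochromatic edges of a colouring

properPart : ∀ {n k} → Graph n → (Fin n → Fin k) → Graph n
properPart G g = record
  { adj    = λ u v → adj G u v ∧ not (does (g u Fin.≟ g v))
  ; sym    = λ u v → cong₂ (λ a b → a ∧ not b) (adj-sym G u v) (≟-sym (g u) (g v))
  ; irrefl = λ v → cong (_∧ not (does (g v Fin.≟ g v))) (irrefl G v)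
  }
  where
  ≟-sym : ∀ {k} (i j : Fin k) → does (i Fin.≟ j) ≡ does (j Fin.≟ i)
  ≟-sym i j with j Fin.≟ i
  ... | yes refl = dec-true (i Fin.≟ i) refl
  ... | no j≢i   = dec-false (i Fin.≟ j) (j≢i ∘ sym)

properPart-colourable : ∀ {n k} (G : Graph n) (g : Fin n → Fin k) → Colourable k (properPart G g)
properPart-colourable G g = g , proper
  where
  proper : ∀ u v → adj (properPart G g) u v ≡ true → g u ≢ g v
  proper u v uv with adj G u v | g u Fin.≟ g v
  proper u v () | false | _
  proper u v () | true  | yes _
  ... | true | no g≢ = g≢

edges-properPart : ∀ {n k} (G : Graph n) (g : Fin n → Fin k) →
  edges G ∸ edges (properPart G g) ≤ monochromatic G g
edges-properPart {n} G g = m≤n+o⇒m∸n≤o _ (edges (properPart G g)) (≤-trans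
  (∑-mono (allFin n) λ u → ∑-mono (allFin n) λ v → pointwise (adj G u v) (does (g u Fin.≟ g v)) (toℕ u <ᵇ toℕ v))
  (≤-reflexive (trans (∑-cong (allFin n) λ u → ∑-+ (allFin n)) (∑-+ (allFin n)))))
  where
  pointwise : ∀ a s o → ⟦ a ∧ o ⟧ ≤ ⟦ (a ∧ not s) ∧ o ⟧ + ⟦ a ∧ s ⟧
  pointwise false s     o     = z≤n
  pointwise true  true  o     = ⟦⟧≤1 o
  pointwise true  false true  = ≤-refl
  pointwise true  false false = z≤n

-- Inequalities between rational multiples of naturals

toℚᵘ-scale : ∀ c x → toℚᵘ (c ℚ.* ℕ→ℚ x) ℚᵘ.≃ mkℚᵘ (↥ c ℤ.* pos x) (ℚ.denominator-1 c)
toℚᵘ-scale c@record{} x = ℚᵘ.≃-trans (ℚ.toℚᵘ-homo-* c (ℕ→ℚ x))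
  (ℚᵘ.≃-trans (ℚᵘ.*-congˡ {toℚᵘ c} (ℚ.toℚᵘ-fromℚᵘ (mkℚᵘ (pos x) 0)))
    (ℚᵘ.*≡* (cong (λ d → ↥ c ℤ.* pos x ℤ.* pos d) (sym (*-identityʳ (suc (ℚ.denominator-1 c)))))))

toℚᵘ-ℕ→ℚ : ∀ x → toℚᵘ (ℕ→ℚ x) ℚᵘ.≃ mkℚᵘ (pos x) 0
toℚᵘ-ℕ→ℚ x = ℚ.toℚᵘ-fromℚᵘ (mkℚᵘ (pos x) 0)

ℕ→ℚ-* : ∀ x y → ℕ→ℚ x ℚ.* ℕ→ℚ y ≡ ℕ→ℚ (x * y)
ℕ→ℚ-* x y = ℚ.toℚᵘ-injective (ℚᵘ.≃-trans (ℚ.toℚᵘ-homo-* (ℕ→ℚ x) (ℕ→ℚ y))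
  (ℚᵘ.≃-trans (ℚᵘ.*-cong (toℚᵘ-ℕ→ℚ x) (toℚᵘ-ℕ→ℚ y))
    (ℚᵘ.≃-trans (ℚᵘ.*≡* (cong (ℤ._* pos 1) (sym (ℤ.pos-* x y)))) (ℚᵘ.≃-sym (toℚᵘ-ℕ→ℚ (x * y))))))

module _ (c : ℚ) (x y : ℕ) where

  scale-≤⁻ : c ℚ.* ℕ→ℚ x ℚ.≤ ℕ→ℚ y → ↥ c ℤ.* pos x ℤ.≤ pos y ℤ.* ↧ c
  scale-≤⁻ le = subst (ℤ._≤ pos y ℤ.* ↧ c) (ℤ.*-identityʳ _)
    (ℚᵘ.drop-*≤* (ℚᵘ.≤-respʳ-≃ (toℚᵘ-ℕ→ℚ y) (ℚᵘ.≤-respˡ-≃ (toℚᵘ-scale c x) (ℚ.toℚᵘ-mono-≤ le))))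

  scale-≤⁺ : ↥ c ℤ.* pos x ℤ.≤ pos y ℤ.* ↧ c → c ℚ.* ℕ→ℚ x ℚ.≤ ℕ→ℚ y
  scale-≤⁺ le = ℚ.toℚᵘ-cancel-≤ (ℚᵘ.≤-respʳ-≃ (ℚᵘ.≃-sym (toℚᵘ-ℕ→ℚ y)) (ℚᵘ.≤-respˡ-≃ (ℚᵘ.≃-sym (toℚᵘ-scale c x))
    (ℚᵘ.*≤* (subst (ℤ._≤ pos y ℤ.* ↧ c) (sym (ℤ.*-identityʳ _)) le))))

  scale-≥⁻ : ℕ→ℚ y ℚ.≤ c ℚ.* ℕ→ℚ x → pos y ℤ.* ↧ c ℤ.≤ ↥ c ℤ.* pos x
  scale-≥⁻ le = subst (pos y ℤ.* ↧ c ℤ.≤_) (ℤ.*-identityʳ _)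
    (ℚᵘ.drop-*≤* (ℚᵘ.≤-respʳ-≃ (toℚᵘ-scale c x) (ℚᵘ.≤-respˡ-≃ (toℚᵘ-ℕ→ℚ y) (ℚ.toℚᵘ-mono-≤ le))))

  scale-≥⁺ : pos y ℤ.* ↧ c ℤ.≤ ↥ c ℤ.* pos x → ℕ→ℚ y ℚ.≤ c ℚ.* ℕ→ℚ x
  scale-≥⁺ le = ℚ.toℚᵘ-cancel-≤ (ℚᵘ.≤-respʳ-≃ (ℚᵘ.≃-sym (toℚᵘ-scale c x)) (ℚᵘ.≤-respˡ-≃ (ℚᵘ.≃-sym (toℚᵘ-ℕ→ℚ y))
    (ℚᵘ.*≤* (subst (pos y ℤ.* ↧ c ℤ.≤_) (sym (ℤ.*-identityʳ _)) le))))

blowup-minDeg : ∀ {n} (G : Graph n) c t → MinDegAtLeast G c → MinDegAtLeast (blowup G t) c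
blowup-minDeg {n} G c t minDeg x = scale-≤⁺ c (n * t) (deg (blowup G t) x)
  (subst₂ ℤ._≤_ (trans (ℤ.*-assoc (↥ c) (pos n) (pos t)) (cong (↥ c ℤ.*_) (sym (ℤ.pos-* n t))))
    (trans (swap (pos (deg G v)) (↧ c) (pos t)) (cong (ℤ._* ↧ c) (trans (sym (ℤ.pos-* t (deg G v))) (cong pos (sym (deg-blowup G t x))))))
    (ℤ.*-monoʳ-≤-nonNeg (pos t) (scale-≤⁻ c n (deg G v) (minDeg v))))
  where
  v = quotient t x
  swap : ∀ a b c → a ℤ.* b ℤ.* c ≡ c ℤ.* a ℤ.* b
  swap = ℤRing.solve-∀

unitFraction : ℕ → ℚ
unitFraction e = mkℚ (pos 1) e (1-coprimeTo (suc e))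

unitFraction-≥⁻ : ∀ e x y → ℕ→ℚ y ℚ.≤ unitFraction e ℚ.* (ℕ→ℚ x ℚ.* ℕ→ℚ x) → suc e * y ≤ x * x
unitFraction-≥⁻ e x y le = ℤ.drop‿+≤+ (subst₂ ℤ._≤_
  (trans (sym (ℤ.pos-* y (suc e))) (cong pos (*-comm y (suc e)))) (ℤ.*-identityˡ (pos (x * x)))
  (scale-≥⁻ (unitFraction e) (x * x) y (subst (λ q → ℕ→ℚ y ℚ.≤ unitFraction e ℚ.* q) (ℕ→ℚ-* x x) le)))

-- Comparison of the two profile sets

-- A blow-up keeps the minimum-degree ratio, and a copy of `H` in it projects to a homomorphism into
-- `G`, so the same `c` serves on both sides.
approx⇒hom : ∀ {h} (H : Graph h) k .{{_ : NonZero k}} c → ApproxProfileSet H k c → HomProfileSet H k c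
-- Blow-ups of the empty graph stay empty and need not reach size `n₀`.
approx⇒hom H k c approx zero      G ¬hom minDeg = (λ ()) , λ ()
approx⇒hom H k c approx n@(suc _) G ¬hom minDeg =
  colour (near (n * t) (blowup G t) (≤-trans (n≤1+n n₀) (m≤n*m t n)) free (blowup-minDeg G c t minDeg))
  where
  e : ℕ
  e = k * k * (n * n)
  η = unitFraction e
  approx-η = approx η (ℚ.*<* (ℤ.+<+ (s≤s z≤n)))
  n₀ t : ℕ
  n₀ = proj₁ approx-η
  -- Positive even when `n₀` is zero, and large enough that `n * t` is at least `n₀`.
  t = suc n₀
  near = proj₂ approx-η
  free : Free H (blowup G t)
  free (φ , _ , hom) = ¬hom (quotient t ∘ φ , hom)
  colour : NearlyColourable k η (blowup G t) → Colourable k G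
  colour (G′ , G′⊆ , (f , proper) , few) = few-deleted⇒Colourable G t k G′ G′⊆ f proper
    (unitFraction-≥⁻ e (n * t) (edges (blowup G t) ∸ edges G′) few)

-- Form with cleared denominators: p/Q is the ratio of the homomorphism profile, and minimum degree
-- `r` must exceed it by 1/Q, the slack that sampling consumes. The alternative `p ≡ 0` covers a
-- profile that demands nothing of degrees.
hom⇒approx-ℕ : ∀ {h} (H : Graph h) k (i₀ : Fin k) p Q .{{_ : NonZero Q}} r →
  (∀ N (F : Graph N) → ¬ Hom H F → (∀ v → p * N ≤ Q * deg F v) → Colourable k F) →
  (∀ n (G : Graph n) → MinDegAtLeast G r → p ≡ 0 ⊎ (∀ v → suc p * n ≤ Q * deg G v)) →
  ApproxProfileSet H k r
hom⇒approx-ℕ H k i₀ p Q r homProfile degrees (mkℚ (pos 0) d-1 _) (ℚ.*<* (ℤ.+<+ ()))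
hom⇒approx-ℕ H k i₀ p Q r homProfile degrees (mkℚ -[1+ _ ] d-1 _) (ℚ.*<* ())
hom⇒approx-ℕ H k i₀ p Q r homProfile degrees η@(mkℚ +[1+ a ] d-1 _) 0<η
  -- `Close` allows 3n²/D monochromatic pairs. Taking D as three times the denominator d of `η`
  -- leaves n²/d, which is at most ηn² since the numerator is positive.
  with homProfile⇒close H k p Q (3 * suc d-1) i₀ homProfile
... | n₀ , closes = n₀ , λ n G n≥n₀ free minDeg → near G (closes n G n≥n₀ free (degrees n G minDeg))
  where
  near : ∀ {n} (G : Graph n) → Close G k (3 * suc d-1) → NearlyColourable k η G
  near {n} G (g , few) = properPart G g , (λ u v → proj₁ ∘ ∧-split (adj G u v) _) , properPart-colourable G g ,
    subst (λ q → ℕ→ℚ del ℚ.≤ η ℚ.* q) (sym (ℕ→ℚ-* n n)) (scale-≥⁺ η (n * n) del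
      (subst₂ ℤ._≤_ (ℤ.pos-* del (suc d-1)) (ℤ.pos-* (suc a) (n * n)) (ℤ.+≤+ (begin
        del * suc d-1                  ≤⟨ *-monoˡ-≤ (suc d-1) (edges-properPart G g) ⟩
        monochromatic G g * suc d-1    ≡⟨ *-comm _ (suc d-1) ⟩
        suc d-1 * monochromatic G g    ≤⟨ *-cancelˡ-≤ 3 (≤-trans (≤-reflexive (sym (*-assoc 3 (suc d-1) _))) few) ⟩
        n * n                          ≤⟨ m≤n*m (n * n) (suc a) ⟩
        suc a * (n * n)                ∎))))
    where
    open ≤-Reasoning
    del = edges G ∸ edges (properPart G g)
    ∧-split : ∀ a b → a ∧ b ≡ true → a ≡ true × b ≡ true
    ∧-split true true _ = refl , refl

hom⇒approx : ∀ {h} (H : Graph h) k → Fin k → ∀ {c r} → c ℚ.< r → HomProfileSet H k c → ApproxProfileSet H k r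
-- A negative `c` puts no condition on degrees, hence p = 0 and Q = 1.
hom⇒approx H k i₀ {c@(mkℚ -[1+ _ ] _ _)} {r} _ homProfile = hom⇒approx-ℕ H k i₀ 0 1 r
  (λ N F ¬hom _ → homProfile N F ¬hom λ v → scale-≤⁺ c N (deg F v) (negative N (deg F v)))
  (λ n G _ → inj₁ refl)
  where
  negative : ∀ x y → ↥ c ℤ.* pos x ℤ.≤ pos y ℤ.* ↧ c
  negative x y = ℤ.≤-trans (ℤ.*-monoʳ-≤-nonNeg (pos x) {↥ c} {pos 0} ℤ.-≤+) (subst (pos 0 ℤ.≤_) (ℤ.pos-* y _) (ℤ.+≤+ z≤n))
hom⇒approx H k i₀ {c@(mkℚ (pos p₀) Q₀-1 _)} {mkℚ -[1+ _ ] _ _} (ℚ.*<* lt) homProfile =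
  contradiction lt (ℤ.≤⇒≯ (ℤ.≤-trans ℤ.-≤+ (subst (pos 0 ℤ.≤_) (ℤ.pos-* p₀ _) (ℤ.+≤+ z≤n))))
hom⇒approx H k i₀ {c@(mkℚ (pos p₀) Q₀-1 _)} {r@(mkℚ (pos p₁) Q₁-1 _)} (ℚ.*<* lt) homProfile =
  -- Over the common denominator the numerators of `c` and `r` are distinct integers, so they differ
  -- by at least one: this is the required slack.
  hom⇒approx-ℕ H k i₀ (p₀ * Q₁) (Q₀ * Q₁) r
    (λ N F ¬hom degrees → homProfile N F ¬hom λ v → scale-≤⁺ c N (deg F v)
      (subst₂ ℤ._≤_ (ℤ.pos-* p₀ N) (ℤ.pos-* (deg F v) Q₀) (ℤ.+≤+ (*-cancelʳ-≤ _ _ Q₁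
        (subst₂ _≤_ (regroup p₀ Q₁ N) (regroup′ Q₀ Q₁ (deg F v)) (degrees v))))))
    (λ n G minDeg → inj₂ λ v → begin
      suc (p₀ * Q₁) * n      ≤⟨ *-monoˡ-≤ n p₀Q₁<p₁Q₀ ⟩
      p₁ * Q₀ * n            ≡⟨ regroup p₁ Q₀ n ⟩
      p₁ * n * Q₀            ≤⟨ *-monoˡ-≤ Q₀ (ℤ.drop‿+≤+ (subst₂ ℤ._≤_ (sym (ℤ.pos-* p₁ n)) (sym (ℤ.pos-* (deg G v) Q₁))
                                  (scale-≤⁻ r n (deg G v) (minDeg v)))) ⟩
      deg G v * Q₁ * Q₀      ≡⟨ regroup″ (deg G v) Q₁ Q₀ ⟩
      Q₀ * Q₁ * deg G v      ∎)
  where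
  open ≤-Reasoning
  Q₀ = suc Q₀-1
  Q₁ = suc Q₁-1
  p₀Q₁<p₁Q₀ : p₀ * Q₁ < p₁ * Q₀
  p₀Q₁<p₁Q₀ = ℤ.drop‿+<+ (subst₂ ℤ._<_ (sym (ℤ.pos-* p₀ Q₁)) (sym (ℤ.pos-* p₁ Q₀)) lt)
  regroup : ∀ a b c → a * b * c ≡ a * c * b
  regroup = solve-∀
  regroup′ : ∀ a b c → a * b * c ≡ c * a * b
  regroup′ = solve-∀
  regroup″ : ∀ a b c → a * b * c ≡ c * b * a
  regroup″ = solve-∀

theorem1p5 : ∀ {h} (H : Graph h) (k : ℕ) → k ≥ 1 → ∀ (q : ℚ) →
    (InfBelow (ApproxProfileSet H k) q → InfBelow (HomProfileSet H k) q) ×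
    (InfBelow (HomProfileSet H k) q → InfBelow (ApproxProfileSet H k) q)
theorem1p5 H k@(suc _) _ q =
  (λ (c , c<q , approx) → c , c<q , approx⇒hom H k c approx) ,
  -- Sampling needs a ratio strictly above `c`; the strict inequality defining `InfBelow` leaves
  -- room for one below `q`.
  (λ (c , c<q , hom) → let r , c<r , r<q = ℚ.<-dense c<q in r , r<q , hom⇒approx H k zero c<r hom)
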